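{- Let $G$ be a simple, finite, connected, undirected partial 2-tree with $n$ vertices and $m$ edges, equipped with an edge weight function $w: E(G)\to \mathbb{N}$ and a total order on $V(G)$. Then the number of lex short cycles of $G$ is $m-n+1$.
   Context: A 2-tree is defined inductively: $K_3$ is a 2-tree; if $G'$ is a 2-tree and $G$ is obtained from $G'$ by adding a new vertex $v$ whose neighbourhood in $G$ induces a $K_2$ (an edge) of $G'$, then $G$ is a 2-tree. A partial 2-tree is a subgraph of a 2-tree (equivalently, a graph of treewidth at most two). For a path $P$, $w(P)=\sum_{e\in E(P)} w(e)$. Given the total order on $V(G)$, a path $P$ between distinct vertices $u,v$ is the lex shortest path if for every other $u$–$v$ path $P'$ exactly one of the following holds: (1) $w(P')>w(P)$; (2) $w(P')=w(P)$ and $|E(P')|>|E(P)|$; (3) $w(P')=w(P)$, $|E(P')|=|E(P)|$ and $\min(V(P')\setminus V(P))>\min(V(P)\setminus V(P'))$. This path is unique and denoted $lsp(u,v)$. A cycle $C$ of $G$ is lex short if for every two vertices $x,y\in V(C)$, $lsp(x,y)$ is contained in $C$. -}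

module Defs where

open import Level using (0ℓ)
open import Data.Nat using (ℕ; zero; suc; _+_; _∸_; _<_; _≤_)
open import Data.Fin using (Fin; zero; suc) renaming (_<?_ to _<ᶠ?_)
open import Data.Fin.Properties using (_≟_)
open import Data.Bool using (Bool; true; false; not; _∧_; _∨_)
open import Data.List using (List; []; _∷_; _++_; [_]; length; head; last; allFin; cartesianProduct; filterᵇ)
open import Data.List.Membership.Propositional using (_∈_)
open import Data.List.Relation.Unary.Linked using (Linked)
open import Data.List.Relation.Unary.Unique.Propositional using (Unique)
open import Data.Maybe using (Maybe; just)
open import Data.Product using (Σ; ∃; _×_; _,_; proj₁; proj₂)
open import Data.Sum using (_⊎_)
open import Relation.Nullary using (¬_)
open import Relation.Nullary.Decidable using (⌊_⌋)
open import Relation.Binary using (Rel)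
open import Relation.Binary.PropositionalEquality using (_≡_; _≢_)
open import Function.Definitions using (Injective)

record Graph (n : ℕ) : Set where
  field
    adj    : Fin n → Fin n → Bool
    sym    : ∀ i j → adj i j ≡ adj j i
    irrefl : ∀ i → adj i i ≡ false
open Graph public

Adj : ∀ {n} → Graph n → Fin n → Fin n → Set
Adj G i j = adj G i j ≡ true

edgeCount : ∀ {n} → Graph n → ℕ
edgeCount {n} G =
  length (filterᵇ (λ p → ⌊ proj₁ p <ᶠ? proj₂ p ⌋ ∧ adj G (proj₁ p) (proj₂ p))
                  (cartesianProduct (allFin n) (allFin n)))

K3 : Fin 3 → Fin 3 → Bool
K3 i j = not ⌊ i ≟ j ⌋

extend : ∀ {k} → (Fin k → Fin k → Bool) → Fin k → Fin k → Fin (suc k) → Fin (suc k) → Bool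
extend T a b zero    zero    = false
extend T a b zero    (suc j) = ⌊ j ≟ a ⌋ ∨ ⌊ j ≟ b ⌋
extend T a b (suc i) zero    = ⌊ i ≟ a ⌋ ∨ ⌊ i ≟ b ⌋
extend T a b (suc i) (suc j) = T i j

data IsTwoTree : (k : ℕ) → (Fin k → Fin k → Bool) → Set where
  base : IsTwoTree 3 K3
  step : ∀ {k T} → IsTwoTree k T → (a b : Fin k) → T a b ≡ true →
         IsTwoTree (suc k) (extend T a b)

IsPartial2Tree : ∀ {n} → Graph n → Set
IsPartial2Tree {n} G =
  Σ ℕ λ k → Σ (Fin k → Fin k → Bool) λ T → IsTwoTree k T ×
    Σ (Fin n → Fin k) λ f → Injective _≡_ _≡_ f ×
      (∀ i j → Adj G i j → T (f i) (f j) ≡ true)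

IsPath : ∀ {n} → Graph n → Fin n → Fin n → List (Fin n) → Set
IsPath G u v p = head p ≡ just u × last p ≡ just v × Unique p × Linked (Adj G) p

Connected : ∀ {n} → Graph n → Set
Connected G = ∀ u v → u ≢ v → ∃ λ p → IsPath G u v p

pathWeight : ∀ {n} → (Fin n → Fin n → ℕ) → List (Fin n) → ℕ
pathWeight w []           = 0
pathWeight w (x ∷ [])     = 0
pathWeight w (x ∷ y ∷ l)  = w x y + pathWeight w (y ∷ l)

numEdges : ∀ {n} → List (Fin n) → ℕ
numEdges p = length p ∸ 1

IsMin : ∀ {n} → Rel (Fin n) 0ℓ → (Fin n → Set) → Fin n → Set
IsMin _≺_ S x = S x × (∀ y → S y → x ≡ y ⊎ x ≺ y)

Diff : ∀ {n} → List (Fin n) → List (Fin n) → Fin n → Set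
Diff A B x = x ∈ A × ¬ (x ∈ B)

IsLexShortest : ∀ {n} → Graph n → (Fin n → Fin n → ℕ) → Rel (Fin n) 0ℓ →
                Fin n → Fin n → List (Fin n) → Set
IsLexShortest {n} G w _≺_ u v P =
  IsPath G u v P ×
  (∀ P′ → IsPath G u v P′ → P′ ≢ P →
     (pathWeight w P < pathWeight w P′)
     ⊎ (pathWeight w P′ ≡ pathWeight w P × numEdges P < numEdges P′)
     ⊎ (pathWeight w P′ ≡ pathWeight w P × numEdges P′ ≡ numEdges P ×
        Σ (Fin n) λ a → Σ (Fin n) λ b →
          IsMin _≺_ (Diff P′ P) a × IsMin _≺_ (Diff P P′) b × b ≺ a))

consec : ∀ {A : Set} → List A → List (A × A)
consec []          = []
consec (x ∷ [])    = []
consec (x ∷ y ∷ l) = (x , y) ∷ consec (y ∷ l)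

close : ∀ {A : Set} → List A → List A
close []      = []
close (x ∷ l) = x ∷ l ++ [ x ]

IsCycle : ∀ {n} → Graph n → List (Fin n) → Set
IsCycle G c = 3 ≤ length c × Unique c × Linked (Adj G) (close c)

CycEdge : ∀ {n} → List (Fin n) → Fin n → Fin n → Set
CycEdge c a b = (a , b) ∈ consec (close c) ⊎ (b , a) ∈ consec (close c)

SameCycle : ∀ {n} → List (Fin n) → List (Fin n) → Set
SameCycle c c′ = ∀ a b → (CycEdge c a b → CycEdge c′ a b) × (CycEdge c′ a b → CycEdge c a b)

PathInCycle : ∀ {n} → List (Fin n) → List (Fin n) → Set
PathInCycle P C = (∀ a → a ∈ P → a ∈ C) × (∀ a b → (a , b) ∈ consec P → CycEdge C a b)

IsLexShortCycle : ∀ {n} → Graph n → (Fin n → Fin n → ℕ) → Rel (Fin n) 0ℓ →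
                  List (Fin n) → Set
IsLexShortCycle {n} G w _≺_ C =
  IsCycle G C ×
  (∀ x y → x ∈ C → y ∈ C → x ≢ y →
     Σ (List (Fin n)) λ P → IsLexShortest G w _≺_ x y P × PathInCycle P C)

-- Lex shortest paths form a path system: one path for each pair of vertices,
-- closed under taking subpaths and under reversal. For any path system on a
-- connected partial 2-tree, the cycles containing the chosen path between any two
-- of their vertices are counted by eliminating a vertex v with at most two
-- neighbours. If v has one neighbour, no cycle passes through it. If v has neighbours
-- a and b and the chosen path P from a to b avoids v, then deleting v loses exactly
-- the cycle v ∷ P. Otherwise P = a v b; contracting v into the edge ab, which may
-- already be present, loses exactly the triangle vab if ab was an edge, and nothing
-- otherwise: the old edge ab lies on no chosen path, hence on no other such cycle.
module Submission where

open import Defs renaming (sym to adj-sym)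
open import Level using (0ℓ)
open import Data.Nat using (ℕ; zero; suc; _+_; _∸_; _<_; _≤_; s≤s; z≤n; _*_; _<?_; s≤s⁻¹)
open import Data.Nat.Properties using (≤-trans; ≤-reflexive; n≤1+n; +-suc; +-comm; +-assoc; +-identityʳ; ≤-refl; ≤-<-trans; <-≤-trans; <-trans; <-irrefl; <-cmp; ≮⇒≥; <⇒≤; m≤n+m; +-monoʳ-<; +-cancelˡ-≤; *-monoˡ-≤; ∸-monoˡ-≤; ∸-monoˡ-<; <⇒≱; ≰⇒>; m≤m+n; module ≤-Reasoning)
open import Data.Fin using (Fin; zero; suc; fromℕ<) renaming (_<_ to _<ᶠ_; _<?_ to _<ᶠ?_)
open import Data.Fin.Properties using (_≟_; suc-injective; <-asym; any?; all?) renaming (<-irrefl to <ᶠ-irrefl)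
open import Data.Bool using (Bool; true; false; _∧_; _∨_; T; T?)
open import Data.List using (List; []; _∷_; _++_; [_]; length; head; last; reverse; filter; initLast; _∷ʳ′_; filterᵇ; map; catMaybes; tabulate; allFin; cartesianProduct; cartesianProductWith)
open import Data.List.Properties using (unfold-reverse; ++-assoc; ++-identityʳ; length-reverse; reverse-++; reverse-involutive; ∷-injectiveˡ; ∷-injectiveʳ; filter-accept; filter-reject; filter-++; length-++; length-tabulate)
open import Data.List.Membership.Propositional using (_∈_; _∉_)
open import Data.List.Membership.Propositional.Properties using (∈-++⁺ˡ; ∈-++⁺ʳ; ∈-++⁻; ∈-∃++; ∈-filter⁺; ∈-filter⁻; ∈-allFin; ∈-cartesianProductWith⁺)
open import Data.List.Relation.Unary.All as All using (All; []; _∷_)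
open import Data.List.Relation.Unary.AllPairs using (AllPairs; []; _∷_)
open import Data.List.Relation.Unary.Any using (Any; here; there)
open import Data.List.Relation.Unary.Any.Properties using (reverse⁺; reverse⁻)
open import Data.List.Relation.Unary.Linked using (Linked; []; [-]; _∷_; linked?)
open import Data.List.Relation.Unary.Unique.Propositional using (Unique)
open import Data.List.Relation.Unary.Unique.Propositional.Properties using (Unique[x∷xs]⇒x∉xs; filter⁺; allFin⁺)
open import Data.List.Relation.Binary.Permutation.Propositional using (_↭_; ↭-sym; prep; ↭⇒↭ₛ)
open import Data.List.Relation.Binary.Permutation.Propositional.Properties using (↭-reverse; ++-comm; ↭-length)
open import Data.List.Relation.Binary.Permutation.Setoid.Properties using (Unique-resp-↭)
open import Data.Maybe using (Maybe; just; nothing)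
open import Data.Maybe.Properties using (just-injective)
open import Data.Product using (Σ; ∃; ∃₂; _×_; _,_; proj₁; proj₂)
open import Data.Sum using (_⊎_; inj₁; inj₂; swap; [_,_]′)
open import Data.Empty using (⊥; ⊥-elim)
open import Relation.Nullary using (¬_; Dec; yes; no; contradiction)
open import Relation.Binary using (Rel; IsStrictTotalOrder; tri<; tri≈; tri>)
open import Relation.Binary.PropositionalEquality using (_≡_; _≢_; refl; sym; trans; cong; cong₂; subst; subst₂; ≢-sym)
open import Relation.Binary.PropositionalEquality.Properties using (setoid)
open import Function using (_∘_; id; mk⇔)
open import Relation.Nullary.Decidable using (⌊_⌋; ¬?; _×-dec_; _⊎-dec_; toSum; _→-dec_; decidable-stable)
open import Data.List.Relation.Unary.All.Properties using (¬Any⇒All¬)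
open import Data.List.Relation.Binary.Pointwise using (Pointwise; []; _∷_; Pointwise-length)
open import Data.Product.Properties using (≡-dec)
open import Data.Nat.Tactic.RingSolver using (solve-∀)
open import Data.List.Relation.Unary.AllPairs.Properties using (tabulate⁺-<)
open import Data.List.Relation.Unary.Unique.DecPropositional using (unique?)
open import Data.List.Relation.Binary.BagAndSetEquality using (∼bag⇒↭)
open import Data.List.Membership.Propositional.Properties.WithK using (unique∧set⇒bag)
import Data.Bool.Properties as Bool
import Data.List.Membership.DecPropositional as DecMem
import Data.List.Properties as List
import Data.List.Relation.Binary.Permutation.Propositional as Perm
import Data.Maybe.Properties as Maybe
import Data.Nat as Nat

-- Lex shortness is not stable under the induction: skipping `v` changes the edge counts and vertex
-- sets of paths, and the contracted edge would need a weight that reproduces all earlier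
-- tie-breaks. What survives is the consistency of the chosen paths, and the counting uses nothing
-- else, hence `PathSystem`. Weights and the vertex order enter only to show that lex shortest paths
-- form such a system. The vertex `v` comes from one fixed elimination order: the vertices of the
-- 2-tree in reverse order of insertion, restricted to those that represent vertices of `G`.
-- Contraction may add the edge `ab`, but `a` and `b` are neighbours of `v` and so adjacent in the
-- 2-tree already; the current graph never leaves the 2-tree, and the same order serves to the end.
-- All graphs keep the vertex type `Fin n`, a removed vertex becoming isolated. The invariant is
-- cycles + vertices = edges + 1, free of subtraction; it starts from one vertex without edges or
-- cycles.

module _ where

  -- Lists, their consecutive pairs and undirected links

  private variable
    A : Set
    a b s t u v x y z : A
    p q l xs ys : List A

  Edge : List A → A → A → Set
  Edge p s t = (s , t) ∈ consec p ⊎ (t , s) ∈ consec p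

  Link : A → A → A → A → Set
  Link x y s t = (s ≡ x × t ≡ y) ⊎ (s ≡ y × t ≡ x)

  link-sym : Link x y s t → Link x y t s
  link-sym (inj₁ (e , f)) = inj₂ (f , e)
  link-sym (inj₂ (e , f)) = inj₁ (f , e)

  link-flip : Link x y s t → Link y x s t
  link-flip = swap

  link-resp : (R : A → A → Set) → (∀ {s t} → R s t → R t s) → R x y → Link x y s t → R s t
  link-resp R R-sym r (inj₁ (refl , refl)) = r
  link-resp R R-sym r (inj₂ (refl , refl)) = R-sym r

  consec-++ : ∀ (xs : List A) s ys → consec (xs ++ s ∷ ys) ≡ consec (xs ++ [ s ]) ++ consec (s ∷ ys)
  consec-++ []           s ys = refl
  consec-++ (x ∷ [])     s ys = refl
  consec-++ (x ∷ y ∷ xs) s ys = cong ((x , y) ∷_) (consec-++ (y ∷ xs) s ys)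

  last-snoc : ∀ (p : List A) → last p ≡ just b → ∃ λ xs → p ≡ xs ++ [ b ]
  last-snoc (x ∷ [])     refl = [] , refl
  last-snoc (x ∷ y ∷ p) e with last-snoc (y ∷ p) e
  ... | xs , f = x ∷ xs , cong (x ∷_) f

  last-++ : ∀ (xs : List A) s ys → last (xs ++ s ∷ ys) ≡ last (s ∷ ys)
  last-++ []           s ys = refl
  last-++ (x ∷ [])     s ys = refl
  last-++ (x ∷ y ∷ xs) s ys = last-++ (y ∷ xs) s ys

  head-∈ : head p ≡ just a → a ∈ p
  head-∈ {p = x ∷ p} refl = here refl

  last-∈ : ∀ (p : List A) → last p ≡ just b → b ∈ p
  last-∈ (x ∷ []) refl = here refl
  last-∈ (x ∷ y ∷ p) e = there (last-∈ (y ∷ p) e)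

  last-reverse : ∀ (p : List A) → last (reverse p) ≡ head p
  last-reverse []      = refl
  last-reverse (x ∷ p) rewrite unfold-reverse x p = last-++ (reverse p) x []

  head-reverse : ∀ (p : List A) → head (reverse p) ≡ last p
  head-reverse p = trans (sym (last-reverse (reverse p))) (cong last (reverse-involutive p))

  head-∷ : ∀ {p : List A} → head p ≡ just a → ∃ λ q → p ≡ a ∷ q
  head-∷ {p = x ∷ p} refl = p , refl

  unique-reverse : Unique p → Unique (reverse p)
  unique-reverse {p = p} = Unique-resp-↭ (setoid _) (↭⇒↭ₛ (↭-sym (↭-reverse p)))

  consec-∈ : ∀ (p : List A) → (s , t) ∈ consec p → s ∈ p × t ∈ p
  consec-∈ (x ∷ y ∷ p) (here refl) = here refl , there (here refl)
  consec-∈ (x ∷ y ∷ p) (there e) with consec-∈ (y ∷ p) e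
  ... | f , g = there f , there g

  consec-∈-tail : ∀ (p : List A) → (s , t) ∈ consec (x ∷ p) → t ∈ p
  consec-∈-tail (y ∷ p) (here refl) = here refl
  consec-∈-tail (y ∷ p) (there e) = proj₂ (consec-∈ (y ∷ p) e)

  edge-∈ : ∀ (p : List A) → Edge p s t → s ∈ p × t ∈ p
  edge-∈ p (inj₁ e) = consec-∈ p e
  edge-∈ p (inj₂ e) = let f , g = consec-∈ p e in g , f

  consec-reverse : ∀ (p : List A) → (s , t) ∈ consec p → (t , s) ∈ consec (reverse p)
  consec-reverse {s = s} {t = t} (x ∷ y ∷ l) e =
    subst (λ p → (t , s) ∈ consec p) (sym eq)
      (subst ((t , s) ∈_) (sym (consec-++ (reverse l) y [ x ])) (go e))
    where
    eq : reverse (x ∷ y ∷ l) ≡ reverse l ++ y ∷ [ x ]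
    eq = trans (unfold-reverse x (y ∷ l))
           (trans (cong (_++ [ x ]) (unfold-reverse y l)) (++-assoc (reverse l) [ y ] [ x ]))
    go : (s , t) ∈ consec (x ∷ y ∷ l) → (t , s) ∈ consec (reverse l ++ [ y ]) ++ (y , x) ∷ []
    go (here refl) = ∈-++⁺ʳ _ (here refl)
    go (there e) = ∈-++⁺ˡ (subst (λ p → (t , s) ∈ consec p) (unfold-reverse y l) (consec-reverse (y ∷ l) e))

  edge-reverse : ∀ (p : List A) → Edge p s t → Edge (reverse p) s t
  edge-reverse p (inj₁ e) = inj₂ (consec-reverse p e)
  edge-reverse p (inj₂ e) = inj₁ (consec-reverse p e)

  linked⇒ : ∀ {R : A → A → Set} → Linked R p → (s , t) ∈ consec p → R s t
  linked⇒ (r ∷ l) (here refl) = r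
  linked⇒ (r ∷ l) (there e) = linked⇒ l e

  ⇒linked : ∀ {R : A → A → Set} (p : List A) → (∀ {s t} → (s , t) ∈ consec p → R s t) → Linked R p
  ⇒linked [] f = []
  ⇒linked (x ∷ []) f = [-]
  ⇒linked (x ∷ y ∷ p) f = f (here refl) ∷ ⇒linked (y ∷ p) (f ∘ there)

  snoc⇒ : ∀ (p : List A) → last p ≡ just b → (s , t) ∈ consec (p ++ [ v ]) → (s , t) ∈ consec p ⊎ (s ≡ b × t ≡ v)
  snoc⇒ (x ∷ []) refl (here refl) = inj₂ (refl , refl)
  snoc⇒ (x ∷ y ∷ p) l (here refl) = inj₁ (here refl)
  snoc⇒ (x ∷ y ∷ p) l (there e) = [ inj₁ ∘ there , inj₂ ]′ (snoc⇒ (y ∷ p) l e)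

  snoc⇐ˡ : ∀ (p : List A) → (s , t) ∈ consec p → (s , t) ∈ consec (p ++ [ v ])
  snoc⇐ˡ (x ∷ y ∷ p) (here refl) = here refl
  snoc⇐ˡ (x ∷ y ∷ p) (there e) = there (snoc⇐ˡ (y ∷ p) e)

  snoc⇐ʳ : ∀ (p : List A) → last p ≡ just b → (b , v) ∈ consec (p ++ [ v ])
  snoc⇐ʳ (x ∷ []) refl = here refl
  snoc⇐ʳ (x ∷ y ∷ p) l = there (snoc⇐ʳ (y ∷ p) l)

  adj-swap : ∀ {n} (G : Graph n) {i j} → Adj G i j → Adj G j i
  adj-swap G {i} {j} e = trans (adj-sym G j i) e

-- Cycles

module _ {n : ℕ} where

  private variable
    c d e : List (Fin n)

  same-refl : SameCycle c c
  same-refl i j = id , id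

  same-sym : SameCycle c d → SameCycle d c
  same-sym f i j = let g , h = f i j in h , g

  same-trans : SameCycle c d → SameCycle d e → SameCycle c e
  same-trans f g i j = (proj₁ (g i j) ∘ proj₁ (f i j)) , (proj₂ (f i j) ∘ proj₂ (g i j))

  cyc-sym : ∀ c {i j : Fin n} → CycEdge c i j → CycEdge c j i
  cyc-sym c = swap

  cyc-∈ : ∀ c {i j : Fin n} → CycEdge c i j → i ∈ c
  cyc-∈ [] (inj₁ ())
  cyc-∈ [] (inj₂ ())
  cyc-∈ (x ∷ l) {i} e = [ id , (λ { (here r) → here r }) ]′ (∈-++⁻ (x ∷ l) (proj₁ (edge-∈ (close (x ∷ l)) e)))

  ∈-cyc : ∀ c {i : Fin n} → i ∈ c → ∃ λ j → CycEdge c i j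
  ∈-cyc (x ∷ l) {i} i∈ = let j , e = go (x ∷ l) i∈ in j , inj₁ e
    where
    go : ∀ m → i ∈ m → ∃ λ j → (i , j) ∈ consec (m ++ [ x ])
    go (y ∷ []) (here refl) = x , here refl
    go (y ∷ z ∷ m) (here refl) = z , here refl
    go (y ∷ z ∷ m) (there i∈) = let j , e = go (z ∷ m) i∈ in j , there e

  same-∈ : SameCycle c d → ∀ {i} → i ∈ c → i ∈ d
  same-∈ {c} {d} f {i} i∈ = let j , e = ∈-cyc c i∈ in cyc-∈ d (proj₁ (f i j) e)

  -- A path p from a to b is read as a cycle in two ways: closed up through a new
  -- apex v, as v ∷ p, or closed up by the pair ab, as p itself.
  cone⇒ : ∀ (p : List (Fin n)) {a b v i j} → head p ≡ just a → last p ≡ just b →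
    CycEdge (v ∷ p) i j → Edge p i j ⊎ Link v a i j ⊎ Link v b i j
  cone⇒ p {a} {b} {v} h l = [ one h , [ inj₁ ∘ swap , inj₂ ∘ [ inj₁ ∘ link-sym , inj₂ ∘ link-sym ]′ ]′ ∘ one h ]′
    where
    one : head p ≡ just a → ∀ {i j} → (i , j) ∈ consec (v ∷ p ++ [ v ]) → Edge p i j ⊎ Link v a i j ⊎ Link v b i j
    one h e with head-∷ h
    one h (here refl) | q , refl = inj₂ (inj₁ (inj₁ (refl , refl)))
    one h (there e) | q , refl with snoc⇒ (_ ∷ q) l e
    ... | inj₁ f = inj₁ (inj₁ f)
    ... | inj₂ f = inj₂ (inj₂ (inj₂ f))

  cone⇐ : ∀ (p : List (Fin n)) {a b v i j} → head p ≡ just a → last p ≡ just b →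
    Edge p i j ⊎ Link v a i j ⊎ Link v b i j → CycEdge (v ∷ p) i j
  cone⇐ p h l with head-∷ h
  ... | q , refl = λ
    { (inj₁ (inj₁ e)) → inj₁ (there (snoc⇐ˡ p e))
    ; (inj₁ (inj₂ e)) → inj₂ (there (snoc⇐ˡ p e))
    ; (inj₂ (inj₁ e)) → link-resp (CycEdge (_ ∷ p)) (cyc-sym (_ ∷ p)) (inj₁ (here refl)) e
    ; (inj₂ (inj₂ e)) → link-resp (CycEdge (_ ∷ p)) (cyc-sym (_ ∷ p)) (inj₂ (there (snoc⇐ʳ p l))) e }

  ring⇒ : ∀ (p : List (Fin n)) {a b i j} → head p ≡ just a → last p ≡ just b →
    CycEdge p i j → Edge p i j ⊎ Link a b i j
  ring⇒ p h l e with head-∷ h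
  ... | q , refl with e
  ... | inj₁ f = [ inj₁ ∘ inj₁ , inj₂ ∘ inj₂ ]′ (snoc⇒ p l f)
  ... | inj₂ f = [ inj₁ ∘ inj₂ , inj₂ ∘ link-sym ∘ inj₂ ]′ (snoc⇒ p l f)

  ring⇐ : ∀ (p : List (Fin n)) {a b i j} → head p ≡ just a → last p ≡ just b →
    Edge p i j ⊎ Link a b i j → CycEdge p i j
  ring⇐ p h l with head-∷ h
  ... | q , refl = λ
    { (inj₁ (inj₁ e)) → inj₁ (snoc⇐ˡ p e)
    ; (inj₁ (inj₂ e)) → inj₂ (snoc⇐ˡ p e)
    ; (inj₂ e) → link-resp (CycEdge p) (cyc-sym p) (inj₂ (snoc⇐ʳ p l)) e }

  cyc-linked : ∀ {R : Fin n → Fin n → Set} → (∀ {i j} → R i j → R j i) → ∀ c →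
    Linked R (close c) → ∀ {i j} → CycEdge c i j → R i j
  cyc-linked R-sym c r = [ linked⇒ r , R-sym ∘ linked⇒ r ]′

  linked-cyc : ∀ {R : Fin n → Fin n → Set} c → (∀ {i j} → CycEdge c i j → R i j) → Linked R (close c)
  linked-cyc c f = ⇒linked (close c) (f ∘ inj₁)

  isCycle-same : ∀ (G : Graph n) → IsCycle G c → c ↭ d → SameCycle c d → IsCycle G d
  isCycle-same {c} {d} G (three , uniq , link) perm same =
    subst (3 ≤_) (↭-length perm) three ,
    Unique-resp-↭ (setoid _) (↭⇒↭ₛ perm) uniq ,
    linked-cyc d (λ e → cyc-linked (λ {i} {j} → adj-swap G) c link (proj₂ (same _ _) e))

  same-∷ʳ : ∀ (x : Fin n) l → SameCycle (x ∷ l) (l ++ [ x ])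
  same-∷ʳ x [] i j = id , id
  same-∷ʳ x (y ∷ l) i j = [ inj₁ ∘ to , inj₂ ∘ to ]′ , [ inj₁ ∘ from , inj₂ ∘ from ]′
    where
    end : last (y ∷ l ++ [ x ]) ≡ just x
    end = last-++ (y ∷ l) x []
    to : ∀ {i j} → (i , j) ∈ consec (x ∷ y ∷ l ++ [ x ]) → (i , j) ∈ consec ((y ∷ l ++ [ x ]) ++ [ y ])
    to (here refl) = snoc⇐ʳ (y ∷ l ++ [ x ]) end
    to (there e) = snoc⇐ˡ (y ∷ l ++ [ x ]) e
    from : ∀ {i j} → (i , j) ∈ consec ((y ∷ l ++ [ x ]) ++ [ y ]) → (i , j) ∈ consec (x ∷ y ∷ l ++ [ x ])
    from e with snoc⇒ (y ∷ l ++ [ x ]) end e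
    ... | inj₁ f = there f
    ... | inj₂ (refl , refl) = here refl

  same-++ : ∀ (p q : List (Fin n)) → SameCycle (p ++ q) (q ++ p)
  same-++ [] q rewrite ++-identityʳ q = same-refl {c = q}
  same-++ (x ∷ p) q = same-trans {c = x ∷ p ++ q} {(p ++ q) ++ [ x ]} {q ++ x ∷ p} (same-∷ʳ x (p ++ q))
    (subst₂ SameCycle (sym (++-assoc p q [ x ])) (++-assoc q [ x ] p) (same-++ p (q ++ [ x ])))

  same-flip : ∀ (x : Fin n) p → SameCycle (x ∷ p) (x ∷ reverse p)
  same-flip x p i j = go p ,
    (λ e → subst (λ r → CycEdge (x ∷ r) i j) (reverse-involutive p) (go (reverse p) e))
    where
    rev-close : ∀ q → reverse (x ∷ q ++ [ x ]) ≡ x ∷ reverse q ++ [ x ]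
    rev-close q = trans (unfold-reverse x (q ++ [ x ])) (cong (_++ [ x ]) (reverse-++ q [ x ]))
    go : ∀ q → CycEdge (x ∷ q) i j → CycEdge (x ∷ reverse q) i j
    go q e = subst (λ r → Edge r i j) (rev-close q) (edge-reverse (x ∷ q ++ [ x ]) e)

  rotate : ∀ (G : Graph n) {v} → IsCycle G c → v ∈ c → ∃ λ p → SameCycle c (v ∷ p) × IsCycle G (v ∷ p)
  rotate G {v} cyc v∈ with ∈-∃++ v∈
  ... | xs , ys , refl = ys ++ xs , same-++ xs (v ∷ ys) ,
        isCycle-same G cyc (++-comm xs (v ∷ ys)) (same-++ xs (v ∷ ys))

  flip-cycle : ∀ (G : Graph n) {v p} → IsCycle G (v ∷ p) → IsCycle G (v ∷ reverse p)
  flip-cycle G {v} {p} cyc = isCycle-same G cyc (prep v (↭-sym (↭-reverse p))) (same-flip v p)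

unique-tail : ∀ {A : Set} {x : A} {p} → Unique (x ∷ p) → Unique p
unique-tail (_ ∷ u) = u

unique-infix : ∀ {A : Set} (xs : List A) {ys} → Unique (xs ++ ys) → Unique ys
unique-infix [] u = u
unique-infix (x ∷ xs) u = unique-infix xs (unique-tail u)

path-trivial : ∀ {n} {G : Graph n} {x p} → IsPath G x x p → p ≡ [ x ]
path-trivial {p = x ∷ []} (refl , _) = refl
path-trivial {p = x ∷ y ∷ p} (refl , l , u , _) = contradiction (last-∈ (y ∷ p) l) (Unique[x∷xs]⇒x∉xs u)

pathIn-reverse : ∀ {n} (p : List (Fin n)) {C} → PathInCycle p C → PathInCycle (reverse p) C
pathIn-reverse p {C} (f , g) = (λ a → f a ∘ reverse⁻) ,
  λ a b e → cyc-sym C (g b a (subst (λ q → (b , a) ∈ consec q) (reverse-involutive p) (consec-reverse (reverse p) e)))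

-- Path systems

-- `vs` lists the vertices still alive; by `support` and symmetry every edge lies within it, so all
-- other vertices of `Fin n` are isolated. Closure under one-step suffixes and under reversal
-- already gives closure under all subpaths, see `lsp-infix`.
record PathSystem {n} (G : Graph n) (vs : List (Fin n)) (lsp : Fin n → Fin n → List (Fin n)) : Set where
  field
    support : ∀ {x y} → Adj G x y → x ∈ vs
    isPath  : ∀ {x y} → x ∈ vs → y ∈ vs → IsPath G x y (lsp x y)
    suffix  : ∀ {x y z q} → x ∈ vs → y ∈ vs → lsp x y ≡ x ∷ z ∷ q → lsp z y ≡ z ∷ q
    rev     : ∀ {x y} → x ∈ vs → y ∈ vs → lsp y x ≡ reverse (lsp x y)

-- The case `x = y` is included because its chosen path is the single vertex, which lies on the
-- cycle anyway; this spares a distinctness hypothesis throughout the counting.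
Short : ∀ {n} → Graph n → (Fin n → Fin n → List (Fin n)) → List (Fin n) → Set
Short G lsp C = IsCycle G C × (∀ x y → x ∈ C → y ∈ C → PathInCycle (lsp x y) C)

module PathSystemProperties {n} {G : Graph n} {ws lsp} (S : PathSystem G ws lsp) where
  open PathSystem S

  private variable
    x y z v a b s t : Fin n
    p q m : List (Fin n)

  adj-∈ʳ : Adj G x y → y ∈ ws
  adj-∈ʳ = support ∘ adj-swap G

  trivial : x ∈ ws → lsp x x ≡ [ x ]
  trivial x∈ = path-trivial {G = G} (isPath x∈ x∈)

  linked-∈ : x ∈ ws → Linked (Adj G) (x ∷ p) → z ∈ x ∷ p → z ∈ ws
  linked-∈ x∈ l (here refl) = x∈
  linked-∈ x∈ (e ∷ l) (there z∈) = linked-∈ (adj-∈ʳ e) l z∈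

  lsp-head : x ∈ ws → y ∈ ws → ∃ λ q → lsp x y ≡ x ∷ q
  lsp-head x∈ y∈ = head-∷ (proj₁ (isPath x∈ y∈))

  lsp-adj : x ∈ ws → y ∈ ws → (s , t) ∈ consec (lsp x y) → Adj G s t
  lsp-adj x∈ y∈ = linked⇒ (proj₂ (proj₂ (proj₂ (isPath x∈ y∈))))

  lsp-∈ : x ∈ ws → y ∈ ws → z ∈ lsp x y → z ∈ ws
  lsp-∈ x∈ y∈ z∈ with lsp-head x∈ y∈ | isPath x∈ y∈
  ... | q , e | _ , _ , _ , l rewrite e = linked-∈ x∈ l z∈

  lsp-starts : x ∈ ws → y ∈ ws → lsp x y ≡ s ∷ p → s ≡ x
  lsp-starts x∈ y∈ e = ∷-injectiveˡ (trans (sym e) (proj₂ (lsp-head x∈ y∈)))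

  suffix′ : x ∈ ws → y ∈ ws → lsp x y ≡ s ∷ z ∷ q → lsp z y ≡ z ∷ q
  suffix′ x∈ y∈ e with lsp-starts x∈ y∈ e
  ... | refl = suffix x∈ y∈ e

  lsp-suffix : ∀ m → x ∈ ws → y ∈ ws → lsp x y ≡ m ++ s ∷ p → lsp s y ≡ s ∷ p
  lsp-suffix [] x∈ y∈ e with lsp-starts x∈ y∈ e
  ... | refl = e
  lsp-suffix (_ ∷ []) x∈ y∈ e = suffix′ x∈ y∈ e
  lsp-suffix (_ ∷ z ∷ m) x∈ y∈ e =
    lsp-suffix (z ∷ m) (lsp-∈ x∈ y∈ (subst (z ∈_) (sym e) (there (here refl)))) y∈ (suffix′ x∈ y∈ e)

  -- Cut off the part before `s`, reverse, cut off what then precedes `t`, and reverse back.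
  lsp-infix : ∀ xs m {ys} → x ∈ ws → y ∈ ws → lsp x y ≡ xs ++ s ∷ m ++ t ∷ ys → lsp s t ≡ s ∷ m ++ [ t ]
  lsp-infix {x} {y} {s} {t} xs m {ys} x∈ y∈ e =
    trans (rev t∈ s∈) (trans (cong reverse back) (reverse-involutive (s ∷ m ++ [ t ])))
    where
    s∈ : s ∈ ws
    s∈ = lsp-∈ x∈ y∈ (subst (s ∈_) (sym e) (∈-++⁺ʳ xs (here refl)))
    t∈ : t ∈ ws
    t∈ = lsp-∈ x∈ y∈ (subst (t ∈_) (sym e) (∈-++⁺ʳ xs (there (∈-++⁺ʳ m (here refl)))))
    flip : ∀ ys → reverse (s ∷ m ++ t ∷ ys) ≡ reverse ys ++ t ∷ reverse (s ∷ m)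
    flip ys = trans (reverse-++ (s ∷ m) (t ∷ ys))
      (trans (cong (_++ reverse (s ∷ m)) (unfold-reverse t ys)) (++-assoc (reverse ys) [ t ] (reverse (s ∷ m))))
    back : lsp t s ≡ reverse (s ∷ m ++ [ t ])
    back = trans (lsp-suffix (reverse ys) y∈ s∈
             (trans (rev s∈ y∈) (trans (cong reverse (lsp-suffix xs x∈ y∈ e)) (flip ys))))
             (sym (flip []))

  cycle-∈ : ∀ {C} → IsCycle G C → x ∈ C → x ∈ ws
  cycle-∈ {C = C} (_ , _ , l) x∈ = support (cyc-linked (adj-swap G) C l (proj₂ (∈-cyc C x∈)))

  short-same : ∀ {C D} → IsCycle G D → SameCycle C D → Short G lsp C → Short G lsp D
  short-same {C} {D} cyc same (_ , f) = cyc , λ x y x∈ y∈ →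
    let g , h = f x y (back x∈) (back y∈) in
    (λ a a∈ → same-∈ {c = C} {D} same (g a a∈)) , (λ a b e → proj₁ (same a b) (h a b e))
    where
    back : x ∈ D → x ∈ C
    back = same-∈ {c = D} {C} (same-sym {c = C} {D} same)

  -- Paths leaving the apex v are handled by suffix: they enter p through a or b.
  cone-short : v ∈ ws → (∀ {x} → Adj G v x → x ≡ a ⊎ x ≡ b) →
    head p ≡ just a → last p ≡ just b → IsCycle G (v ∷ p) →
    (∀ x y → x ∈ p → y ∈ p → PathInCycle (lsp x y) (v ∷ p)) → Short G lsp (v ∷ p)
  cone-short {v} {a} {b} {p} v∈ nbr h l cyc f = cyc , go
    where
    from-apex : ∀ y → y ∈ p → PathInCycle (lsp v y) (v ∷ p)
    from-apex y y∈ with lsp-head v∈ (cycle-∈ {C = v ∷ p} cyc (there y∈))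
    ... | [] , e rewrite e = (λ { x (here refl) → here refl }) , λ _ _ ()
    ... | z ∷ q , e = subst (λ r → PathInCycle r (v ∷ p)) (sym e)
          ((λ { x (here refl) → here refl ; x (there x∈) → proj₁ rest x x∈ }) ,
           (λ { s t (here refl) → first ; s t (there e) → proj₂ rest s t e }))
      where
      y∈ws = cycle-∈ {C = v ∷ p} cyc (there y∈)
      z-nbr : z ≡ a ⊎ z ≡ b
      z-nbr = nbr (lsp-adj v∈ y∈ws (subst (λ r → (v , z) ∈ consec r) (sym e) (here refl)))
      z∈ : z ∈ p
      z∈ = [ (λ { refl → head-∈ h }) , (λ { refl → last-∈ p l }) ]′ z-nbr
      first : CycEdge (v ∷ p) v z
      first = cone⇐ p h l (inj₂ ([ (λ e → inj₁ (inj₁ (refl , e))) , (λ e → inj₂ (inj₁ (refl , e))) ]′ z-nbr))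
      rest : PathInCycle (z ∷ q) (v ∷ p)
      rest = subst (λ r → PathInCycle r (v ∷ p)) (suffix v∈ y∈ws e) (f z y z∈ y∈)
    go : ∀ x y → x ∈ v ∷ p → y ∈ v ∷ p → PathInCycle (lsp x y) (v ∷ p)
    go x y (here refl) (here refl) rewrite trivial v∈ = (λ { x (here refl) → here refl }) , λ _ _ ()
    go x y (here refl) (there y∈) = from-apex y y∈
    go x y (there x∈) (here refl) = subst (λ r → PathInCycle r (v ∷ p))
      (sym (rev v∈ (cycle-∈ {C = v ∷ p} cyc (there x∈)))) (pathIn-reverse (lsp v x) (from-apex x x∈))
    go x y (there x∈) (there y∈) = f x y x∈ y∈

  -- An inner vertex `v` of a chosen path has two distinct neighbours beside it, and the stretch
  -- between them is itself chosen. So the neighbours of `v` decide whether chosen paths between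
  -- other vertices pass through `v`: never if there is only one, and with two only if `v` lies on
  -- the chosen path between them.
  through : x ∈ ws → y ∈ ws → x ≢ v → y ≢ v → v ∈ lsp x y →
    ∃₂ λ s t → (s , v) ∈ consec (lsp x y) × (v , t) ∈ consec (lsp x y) × s ≢ t × lsp s t ≡ s ∷ v ∷ t ∷ []
  through {x} {y} {v} x∈ y∈ x≢v y≢v v∈ with ∈-∃++ v∈ | isPath x∈ y∈
  ... | pre , post , e | h , l , u , _ with initLast pre | post
  ... | [] | _ rewrite e = contradiction (sym (just-injective h)) x≢v
  ... | xs ∷ʳ′ s | [] rewrite e = contradiction (just-injective (trans (sym l) (last-++ (xs ++ [ s ]) v []))) y≢v
  ... | xs ∷ʳ′ s | t ∷ ys =
    s , t , subst (λ r → (s , v) ∈ consec r) (sym e′) (at xs (here refl)) ,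
    subst (λ r → (v , t) ∈ consec r) (sym e′) (at xs (there (here refl))) ,
    (λ { refl → Unique[x∷xs]⇒x∉xs (unique-infix xs (subst Unique e′ u)) (there (here refl)) }) ,
    lsp-infix xs [ v ] x∈ y∈ e′
    where
    e′ : lsp x y ≡ xs ++ s ∷ v ∷ t ∷ ys
    e′ = trans e (++-assoc xs [ s ] (v ∷ t ∷ ys))
    at : ∀ xs {i} → i ∈ consec (s ∷ v ∷ t ∷ ys) → i ∈ consec (xs ++ s ∷ v ∷ t ∷ ys)
    at xs {i} i∈ = subst (i ∈_) (sym (consec-++ xs s (v ∷ t ∷ ys))) (∈-++⁺ʳ _ i∈)

open PathSystem

fromDec : ∀ {n} {P : Fin n → Fin n → Set} → (∀ i j → Dec (P i j)) →
  (∀ {i j} → P i j → P j i) → (∀ {i} → ¬ P i i) → Graph n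
fromDec P? P-sym P-irr = record
  { adj = λ i j → ⌊ P? i j ⌋
  ; sym = sym′
  ; irrefl = irr }
  where
  sym′ : ∀ i j → ⌊ P? i j ⌋ ≡ ⌊ P? j i ⌋
  sym′ i j with P? i j | P? j i
  ... | yes p | yes q = refl
  ... | no ¬p | no ¬q = refl
  ... | yes p | no ¬q = contradiction (P-sym p) ¬q
  ... | no ¬p | yes q = contradiction (P-sym q) ¬p
  irr : ∀ i → ⌊ P? i i ⌋ ≡ false
  irr i with P? i i
  ... | yes p = contradiction p P-irr
  ... | no _ = refl

⌊⌋⇒ : ∀ {P : Set} (P? : Dec P) → ⌊ P? ⌋ ≡ true → P
⌊⌋⇒ (yes p) _ = p

⇒⌊⌋ : ∀ {P : Set} (P? : Dec P) → P → ⌊ P? ⌋ ≡ true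
⇒⌊⌋ (yes _) _ = refl
⇒⌊⌋ (no ¬p) p = contradiction p ¬p

adj-irrefl : ∀ {n} (G : Graph n) {i} → ¬ Adj G i i
adj-irrefl G {i} e with trans (sym e) (irrefl G i)
... | ()

-- A cycle is a list only up to its set of edges, so the number of short cycles is expressed by a
-- complete list of pairwise inequivalent representatives.
Enumerates : ∀ {n} → Graph n → (Fin n → Fin n → List (Fin n)) → List (List (Fin n)) → Set
Enumerates G lsp L = All (Short G lsp) L × AllPairs (λ c c′ → ¬ SameCycle c c′) L ×
  (∀ C → Short G lsp C → Any (SameCycle C) L)

-- At `x` the path `x ∷ p` has only its first edge, so both paths take the same first step. The
-- remaining edges of the second path avoid `x`, hence the inclusion of edges passes to the tails.
follow : ∀ {A : Set} {b : A} x p q → Unique (x ∷ p) → Unique (x ∷ q) →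
  last (x ∷ p) ≡ just b → last (x ∷ q) ≡ just b →
  (∀ {s t} → (s , t) ∈ consec (x ∷ q) → Edge (x ∷ p) s t) → q ≡ p
follow x [] [] u u′ l l′ f = refl
follow x (y ∷ p) [] u u′ l refl f = contradiction (last-∈ (y ∷ p) l) (Unique[x∷xs]⇒x∉xs u)
follow x [] (z ∷ q) u u′ refl l′ f = contradiction (last-∈ (z ∷ q) l′) (Unique[x∷xs]⇒x∉xs u′)
follow x (y ∷ p) (z ∷ q) u u′ l l′ f with f (here refl)
... | inj₂ e = contradiction (consec-∈-tail (y ∷ p) e) (Unique[x∷xs]⇒x∉xs u)
... | inj₁ (there e) = contradiction (proj₁ (consec-∈ (y ∷ p) e)) (Unique[x∷xs]⇒x∉xs u)
... | inj₁ (here refl) = cong (y ∷_) (follow y p q (unique-tail u) (unique-tail u′) l l′ rest)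
  where
  x∉ = Unique[x∷xs]⇒x∉xs u′
  rest : ∀ {s t} → (s , t) ∈ consec (y ∷ q) → Edge (y ∷ p) s t
  rest e with f (there e)
  ... | inj₁ (there g) = inj₁ g
  ... | inj₂ (there g) = inj₂ g
  ... | inj₁ (here refl) = contradiction (proj₁ (consec-∈ (y ∷ q) e)) x∉
  ... | inj₂ (here refl) = contradiction (proj₂ (consec-∈ (y ∷ q) e)) x∉

nonempty-last : ∀ {A : Set} (x : A) q → ∃ λ t → last (x ∷ q) ≡ just t
nonempty-last x [] = x , refl
nonempty-last x (y ∷ q) = nonempty-last y q

consec-++⁺ʳ : ∀ {A : Set} (xs : List A) {p i} → i ∈ consec p → i ∈ consec (xs ++ p)
consec-++⁺ʳ xs {s ∷ p} {i} e = subst (i ∈_) (sym (consec-++ xs s p)) (∈-++⁺ʳ _ e)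

consec-++⁺ˡ : ∀ {A : Set} (p : List A) {ys i} → i ∈ consec p → i ∈ consec (p ++ ys)
consec-++⁺ˡ (x ∷ y ∷ p) (here e) = here e
consec-++⁺ˡ (x ∷ y ∷ p) (there e) = there (consec-++⁺ˡ (y ∷ p) e)

pathIn-infix : ∀ {n} (xs p ys : List (Fin n)) {C} → PathInCycle (xs ++ p ++ ys) C → PathInCycle p C
pathIn-infix xs p ys (f , g) =
  (λ a → f a ∘ ∈-++⁺ʳ xs ∘ ∈-++⁺ˡ) , (λ a b → g a b ∘ consec-++⁺ʳ xs ∘ consec-++⁺ˡ p)

-- Deleting a vertex

record Degree2 {n} (G : Graph n) (v a b : Fin n) : Set where
  field
    a≢b   : a ≢ b
    va    : Adj G v a
    vb    : Adj G v b
    nbrs  : ∀ {x} → Adj G v x → x ≡ a ⊎ x ≡ b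

  pair : ∀ {s t} → Adj G v s → Adj G v t → s ≢ t → Link a b s t
  pair e f s≢t with nbrs e | nbrs f
  ... | inj₁ refl | inj₁ refl = contradiction refl s≢t
  ... | inj₁ refl | inj₂ refl = inj₁ (refl , refl)
  ... | inj₂ refl | inj₁ refl = inj₂ (refl , refl)
  ... | inj₂ refl | inj₂ refl = contradiction refl s≢t

module _ {n} (G : Graph n) {v : Fin n} where

  -- The two neighbours of `v` on the cycle are distinct because a cycle has at least three
  -- vertices.
  cycle-ends : ∀ {C} → IsCycle G C → v ∈ C → ∃ λ p → ∃₂ λ s t → SameCycle C (v ∷ p) × IsCycle G (v ∷ p) ×
    head p ≡ just s × last p ≡ just t × Adj G v s × Adj G v t × s ≢ t
  cycle-ends cyc v∈ with rotate G cyc v∈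
  ... | _ ∷ [] , same , (s≤s (s≤s ()) , _)
  ... | s ∷ x ∷ q , same , cyc′@(_ , _ ∷ u , e ∷ l) with nonempty-last x q
  ... | t , f = s ∷ x ∷ q , s , t , same , cyc′ , refl , f , e ,
    adj-swap G (linked⇒ l (snoc⇐ʳ (s ∷ x ∷ q) f)) ,
    λ { refl → Unique[x∷xs]⇒x∉xs u (last-∈ (x ∷ q) f) }

  -- With `v` rotated to the front, its two neighbours on the cycle can only be `a` and `b`; a
  -- reflection fixes which of them comes first.
  apex : ∀ {C a b} → Degree2 G v a b → IsCycle G C → v ∈ C →
    ∃ λ p → head p ≡ just a × last p ≡ just b × SameCycle C (v ∷ p) × IsCycle G (v ∷ p)
  apex {C} D cyc v∈ with cycle-ends cyc v∈
  ... | p , s , t , same , cyc′ , h , l , vs , vt , s≢t with Degree2.pair D vs vt s≢t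
  ... | inj₁ (refl , refl) = p , h , l , same , cyc′
  ... | inj₂ (refl , refl) = reverse p , trans (head-reverse p) l , trans (last-reverse p) h ,
        same-trans {c = C} {v ∷ p} {v ∷ reverse p} same (same-flip v p) , flip-cycle G cyc′

-- Common frame of the two reductions: `Q` is the set of edges added when `v` is isolated, empty for
-- deletion and the pair `ab` for contraction.
module Minor {n} (G : Graph n) (v : Fin n) {Q : Fin n → Fin n → Set} (Q? : ∀ i j → Dec (Q i j))
             (Q-sym : ∀ {i j} → Q i j → Q j i) (Q-irr : ∀ {i} → ¬ Q i i) where

  P : Fin n → Fin n → Set
  P i j = i ≢ v × j ≢ v × (Adj G i j ⊎ Q i j)

  P? : ∀ i j → Dec (P i j)
  P? i j = ¬? (i ≟ v) ×-dec ¬? (j ≟ v) ×-dec (adj G i j Bool.≟ true ⊎-dec Q? i j)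

  G′ : Graph n
  G′ = fromDec P? (λ { (f , g , e) → g , f , [ inj₁ ∘ adj-swap G , inj₂ ∘ Q-sym ]′ e })
         (λ { (_ , _ , inj₁ e) → adj-irrefl G e ; (_ , _ , inj₂ e) → Q-irr e })

  adj⇒ : ∀ {i j} → Adj G′ i j → P i j
  adj⇒ {i} {j} = ⌊⌋⇒ (P? i j)

  ⇒adj : ∀ {i j} → P i j → Adj G′ i j
  ⇒adj {i} {j} = ⇒⌊⌋ (P? i j)

  avoids : ∀ {C} → IsCycle G′ C → v ∉ C
  avoids {C} (_ , _ , l) v∈ =
    proj₁ (adj⇒ (cyc-linked (adj-swap G′) C l (proj₂ (∈-cyc C v∈)))) refl

  up : ∀ {C} → IsCycle G C → v ∉ C → IsCycle G′ C
  up {C} (three , u , l) v∉ = three , u , linked-cyc C λ e →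
    ⇒adj ((λ { refl → v∉ (cyc-∈ C e) }) , (λ { refl → v∉ (cyc-∈ C (cyc-sym C e)) }) ,
          inj₁ (cyc-linked (adj-swap G) C l e))

  down : ∀ {C} → IsCycle G′ C → (∀ {i j} → CycEdge C i j → ¬ Q i j) → IsCycle G C
  down {C} (three , u , l) ¬Q = three , u , linked-cyc C λ e →
    [ id , (λ q → contradiction q (¬Q e)) ]′ (proj₂ (proj₂ (adj⇒ (cyc-linked (adj-swap G′) C l e))))

-- By `avoid` the chosen paths between remaining vertices can be kept unchanged when `v` goes.
module Deletion {n} {G : Graph n} {v vs lsp} (S : PathSystem G (v ∷ vs) lsp) (v∉vs : v ∉ vs)
                (avoid : ∀ {x y} → x ∈ vs → y ∈ vs → v ∉ lsp x y) where

  open Minor G v {λ _ _ → ⊥} (λ _ _ → no id) id id public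
  open PathSystemProperties S

  ≢v : ∀ {x} → x ∈ vs → x ≢ v
  ≢v x∈ refl = v∉vs x∈

  system : PathSystem G′ vs lsp
  system = record
    { support = λ e → let x≢v , _ , f = adj⇒ e in
        [ (λ g → case-∈ x≢v (support S g)) , ⊥-elim ]′ f
    ; isPath = λ x∈ y∈ → let h , l , u , k = isPath S (there x∈) (there y∈) in
        h , l , u , ⇒linked _ λ e → let s∈ , t∈ = consec-∈ _ e in
          ⇒adj ((λ { refl → avoid x∈ y∈ s∈ }) , (λ { refl → avoid x∈ y∈ t∈ }) , inj₁ (linked⇒ k e))
    ; suffix = λ x∈ y∈ → suffix S (there x∈) (there y∈)
    ; rev = λ x∈ y∈ → rev S (there x∈) (there y∈) }
    where
    case-∈ : ∀ {x} → x ≢ v → x ∈ v ∷ vs → x ∈ vs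
    case-∈ x≢v (here e) = contradiction e x≢v
    case-∈ x≢v (there x∈) = x∈

  short-down : ∀ {C} → Short G′ lsp C → Short G lsp C
  short-down (cyc , f) = down cyc (λ _ ()) , f

  short-up : ∀ {C} → Short G lsp C → v ∉ C → Short G′ lsp C
  short-up (cyc , f) v∉ = up cyc v∉ , f

  enumerates-pendant : ∀ {L} → (∀ {C} → IsCycle G C → v ∉ C) → Enumerates G′ lsp L → Enumerates G lsp L
  enumerates-pendant none (all , distinct , complete) =
    All.map short-down all , distinct , λ C sh → complete C (short-up sh (none (proj₁ sh)))

  module _ {a b} (D : Degree2 G v a b) where
    open Degree2 D

    nbr∈ : ∀ {x} → Adj G v x → x ∈ vs
    nbr∈ {x} e with adj-∈ʳ e
    ... | here refl = contradiction e (adj-irrefl G)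
    ... | there x∈ = x∈

    private
      p = lsp a b
      ends = isPath S (there (nbr∈ va)) (there (nbr∈ vb))
      h = proj₁ ends
      l = proj₁ (proj₂ ends)
      u = proj₁ (proj₂ (proj₂ ends))
      k = proj₂ (proj₂ (proj₂ ends))
      v∉p : v ∉ p
      v∉p = avoid (nbr∈ va) (nbr∈ vb)

    cone-cycle : IsCycle G (v ∷ p)
    cone-cycle = s≤s (two p h l) , ¬Any⇒All¬ p v∉p ∷ u , linked-cyc (v ∷ p) λ e → edge (cone⇒ p h l e)
      where
      two : ∀ p → head p ≡ just a → last p ≡ just b → 2 ≤ length p
      two (x ∷ []) refl refl = contradiction refl a≢b
      two (x ∷ y ∷ p) _ _ = s≤s (s≤s z≤n)
      edge : ∀ {i j} → Edge p i j ⊎ Link v a i j ⊎ Link v b i j → Adj G i j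
      edge (inj₁ (inj₁ e)) = linked⇒ k e
      edge (inj₁ (inj₂ e)) = adj-swap G (linked⇒ k e)
      edge (inj₂ (inj₁ e)) = link-resp (Adj G) (adj-swap G) va e
      edge (inj₂ (inj₂ e)) = link-resp (Adj G) (adj-swap G) vb e

    -- Both vertices lie on the chosen path from `a` to `b`, so the piece of it between them is
    -- chosen by `lsp-infix`, up to reversal when `y` comes first.
    cone-convex : ∀ x y → x ∈ p → y ∈ p → PathInCycle (lsp x y) (v ∷ p)
    cone-convex x y x∈ y∈ = go (∈-∃++ x∈)
      where
      a∈ : a ∈ v ∷ vs
      a∈ = there (nbr∈ va)
      b∈ : b ∈ v ∷ vs
      b∈ = there (nbr∈ vb)
      x∈ws = lsp-∈ a∈ b∈ x∈
      y∈ws = lsp-∈ a∈ b∈ y∈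
      whole : PathInCycle p (v ∷ p)
      whole = (λ _ → there) , λ _ _ e → cone⇐ p h l (inj₁ (inj₁ e))
      part : ∀ {s t} zs m ys → p ≡ zs ++ s ∷ m ++ t ∷ ys → PathInCycle (lsp s t) (v ∷ p)
      part {s} {t} zs m ys e = subst (λ r → PathInCycle r (v ∷ p)) (sym (lsp-infix zs m a∈ b∈ e))
        (pathIn-infix zs (s ∷ m ++ [ t ]) ys (subst (λ r → PathInCycle r (v ∷ p))
          (trans e (cong (λ r → zs ++ s ∷ r) (sym (++-assoc m [ t ] ys)))) whole))
      go : ∃₂ (λ xs ys → p ≡ xs ++ x ∷ ys) → PathInCycle (lsp x y) (v ∷ p)
      go (xs , ys , e) with ∈-++⁻ xs (subst (y ∈_) e y∈)
      go (xs , ys , e) | inj₁ y∈xs with ∈-∃++ y∈xs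
      ... | zs , m , refl = subst (λ r → PathInCycle r (v ∷ p)) (sym (rev S y∈ws x∈ws))
        (pathIn-reverse (lsp y x) (part zs m ys (trans e (++-assoc zs (y ∷ m) (x ∷ ys)))))
      go (xs , ys , e) | inj₂ (here refl) rewrite trivial x∈ws =
        (λ { _ (here refl) → there x∈ }) , λ _ _ ()
      go (xs , ys , e) | inj₂ (there y∈ys) with ∈-∃++ y∈ys
      ... | m , zs , refl = part xs m zs e

    cone-is-short : Short G lsp (v ∷ p)
    cone-is-short = cone-short (here refl) nbrs h l cone-cycle cone-convex

    -- A cycle through `v` contains `a` and `b`, hence all of `p` if it is short. Read as `v ∷ q`,
    -- its edges away from `v` form the path `q`, which has the same ends as `p` and contains the
    -- edges of `p`, so `follow` identifies the two.
    cone-unique : ∀ {C} → Short G lsp C → v ∈ C → SameCycle C (v ∷ p)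
    cone-unique {C} (cyc , f) v∈ with apex G D cyc v∈
    ... | q , hq , lq , same , cyc′ with head-∷ h | head-∷ hq | f a b (back (there (head-∈ hq))) (back (there (last-∈ q lq)))
      where
      back : ∀ {x} → x ∈ v ∷ q → x ∈ C
      back = same-∈ {c = v ∷ q} {C} (same-sym {c = C} {v ∷ q} same)
    ... | p′ , e | q′ , refl | _ , g = subst (SameCycle C) (cong (v ∷_) (sym (trans e (cong (a ∷_)
            (follow a q′ p′ (unique-tail (proj₁ (proj₂ cyc′))) (subst Unique e u) lq
              (trans (cong last (sym e)) l) edge))))) same
      where
      edge : ∀ {s t} → (s , t) ∈ consec (a ∷ p′) → Edge (a ∷ q′) s t
      edge {s} {t} i with subst (λ r → (s , t) ∈ consec r) (sym e) i
      ... | i′ with cone⇒ (a ∷ q′) hq lq (proj₁ (same s t) (g s t i′))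
      ... | inj₁ r = r
      ... | inj₂ r = ⊥-elim ([ at , at ]′ r)
        where
        at : ∀ {w} → ¬ Link v w s t
        at (inj₁ (refl , _)) = v∉p (proj₁ (consec-∈ p i′))
        at (inj₂ (_ , refl)) = v∉p (proj₂ (consec-∈ p i′))

    enumerates-cone : ∀ {L} → Enumerates G′ lsp L → Enumerates G lsp ((v ∷ p) ∷ L)
    enumerates-cone {L} (all , distinct , complete) =
      cone-is-short ∷ All.map short-down all ,
      All.map (λ {C} sh same → avoids (proj₁ sh) (same-∈ {c = v ∷ p} {C} same (here refl))) all ∷ distinct ,
      λ C sh → find C sh (v ∈? C)
      where
      open DecMem (_≟_ {n}) using (_∈?_)
      find : ∀ C → Short G lsp C → Dec (v ∈ C) → Any (SameCycle C) ((v ∷ p) ∷ L)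
      find C sh (yes v∈) = here (cone-unique sh v∈)
      find C sh (no v∉) = there (complete C (short-up sh v∉))

-- Contracting a vertex into the edge joining its two neighbours

module Skip {n : ℕ} (v : Fin n) where

  private variable
    x y s t : Fin n
    p : List (Fin n)

  skip : List (Fin n) → List (Fin n)
  skip = filter (λ x → ¬? (x ≟ v))

  skip-≢ : x ≢ v → skip (x ∷ p) ≡ x ∷ skip p
  skip-≢ = filter-accept (λ x → ¬? (x ≟ v))

  skip-v : skip (v ∷ p) ≡ skip p
  skip-v = filter-reject (λ x → ¬? (x ≟ v)) (λ f → f refl)

  skip-∉ : v ∉ p → skip p ≡ p
  skip-∉ {[]} v∉ = refl
  skip-∉ {x ∷ p} v∉ = trans (skip-≢ (λ e → v∉ (here (sym e)))) (cong (x ∷_) (skip-∉ (v∉ ∘ there)))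

  ∈-skip : x ∈ p → x ≢ v → x ∈ skip p
  ∈-skip = ∈-filter⁺ (λ x → ¬? (x ≟ v))

  skip-∈ : ∀ p → x ∈ skip p → x ∈ p × x ≢ v
  skip-∈ p = ∈-filter⁻ (λ x → ¬? (x ≟ v)) {xs = p}

  skip-++ : ∀ p q → skip (p ++ q) ≡ skip p ++ skip q
  skip-++ = filter-++ (λ x → ¬? (x ≟ v))

  skip-head : ∀ p → head p ≡ just x → x ≢ v → head (skip p) ≡ just x
  skip-head p h x≢v with head-∷ h
  ... | q , refl rewrite skip-≢ {p = q} x≢v = refl

  skip-last : ∀ p → last p ≡ just y → y ≢ v → last (skip p) ≡ just y
  skip-last {y} p l y≢v with last-snoc p l
  ... | xs , refl rewrite skip-++ xs [ y ] | skip-≢ {p = []} y≢v = last-++ (skip xs) y []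

  skip-reverse : ∀ p → skip (reverse p) ≡ reverse (skip p)
  skip-reverse [] = refl
  skip-reverse (x ∷ p) = trans (cong skip (unfold-reverse x p))
    (trans (skip-++ (reverse p) [ x ]) (trans (cong (_++ skip [ x ]) (skip-reverse p)) (go (x ≟ v))))
    where
    go : Dec (x ≡ v) → reverse (skip p) ++ skip [ x ] ≡ reverse (skip (x ∷ p))
    go (yes refl) rewrite skip-v {[]} | skip-v {p} = ++-identityʳ _
    go (no x≢v) rewrite skip-≢ {p = []} x≢v | skip-≢ {p = p} x≢v = sym (unfold-reverse x (skip p))

  Merged : Fin n → Fin n → List (Fin n) → Set
  Merged s t p = (s , t) ∈ consec p ⊎ ((s , v) ∈ consec p × (v , t) ∈ consec p)

  merged-∷ : ∀ x → Merged s t p → Merged s t (x ∷ p)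
  merged-∷ x = [ inj₁ ∘ consec-++⁺ʳ [ x ] , (λ (e , f) → inj₂ (consec-++⁺ʳ [ x ] e , consec-++⁺ʳ [ x ] f)) ]′

  -- Skipping closes a gap only at `v`, and since `v` occurs at most once the gap is one vertex
  -- wide.
  skip-consec⇒ : ∀ p → Unique p → (s , t) ∈ consec (skip p) → Merged s t p
  skip-consec⇒ [] u ()
  skip-consec⇒ (x ∷ []) u e with x ≟ v
  skip-consec⇒ (x ∷ []) u () | yes _
  skip-consec⇒ (x ∷ []) u () | no _
  skip-consec⇒ {s} {t} (x ∷ y ∷ p) u e =
    -- Both recursive results are handed over because the case `y = v` has to continue behind `v`,
    -- two vertices further on.
    go p (x ≟ v) (y ≟ v) u e (skip-consec⇒ (y ∷ p) (unique-tail u)) (skip-consec⇒ p (unique-tail (unique-tail u)))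
    where
    go : ∀ p → Dec (x ≡ v) → Dec (y ≡ v) → Unique (x ∷ y ∷ p) → (s , t) ∈ consec (skip (x ∷ y ∷ p)) →
      ((s , t) ∈ consec (skip (y ∷ p)) → Merged s t (y ∷ p)) →
      ((s , t) ∈ consec (skip p) → Merged s t p) → Merged s t (x ∷ y ∷ p)
    go p (yes refl) _ u e rec-y rec-p rewrite skip-v {y ∷ p} = merged-∷ x (rec-y e)
    go p (no x≢v) (no y≢v) u e rec-y rec-p rewrite skip-≢ {p = y ∷ p} x≢v | skip-≢ {p = p} y≢v with e
    ... | here f = inj₁ (here f)
    ... | there f = merged-∷ x (rec-y f)
    go [] (no x≢v) (yes refl) u e _ _ rewrite skip-≢ {p = [ v ]} x≢v | skip-v {[]} = contradiction e λ ()
    go (z ∷ p) (no x≢v) (yes refl) u e _ rec-p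
      with (λ (f : z ≡ v) → Unique[x∷xs]⇒x∉xs (unique-tail u) (here (sym f)))
    ... | z≢v rewrite skip-≢ {p = v ∷ z ∷ p} x≢v | skip-v {z ∷ p} | skip-≢ {p = p} z≢v with e
    ... | here refl = inj₂ (here refl , there (here refl))
    ... | there f = merged-∷ x (merged-∷ v (rec-p f))

  skip-consec⇐ : ∀ p → (s , t) ∈ consec p → s ≢ v → t ≢ v → (s , t) ∈ consec (skip p)
  skip-consec⇐ (x ∷ y ∷ p) (here refl) s≢v t≢v rewrite skip-≢ {p = y ∷ p} s≢v | skip-≢ {p = p} t≢v = here refl
  skip-consec⇐ (x ∷ y ∷ p) (there e) s≢v t≢v with x ≟ v | skip-consec⇐ (y ∷ p) e s≢v t≢v
  ... | yes refl | f = f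
  ... | no x≢v | f = consec-++⁺ʳ [ x ] f

  skip-consec-v : ∀ p → Unique p → (s , v) ∈ consec p → (v , t) ∈ consec p → s ≢ v → t ≢ v →
    (s , t) ∈ consec (skip p)
  skip-consec-v (x ∷ y ∷ p) u e (here refl) s≢v t≢v =
    contradiction (consec-∈-tail (y ∷ p) e) (Unique[x∷xs]⇒x∉xs u)
  skip-consec-v (x ∷ .v ∷ z ∷ p) u (here refl) (there (here refl)) s≢v t≢v
    rewrite skip-≢ {p = v ∷ z ∷ p} s≢v | skip-v {z ∷ p} | skip-≢ {p = p} t≢v = here refl
  skip-consec-v (x ∷ .v ∷ z ∷ p) u (here refl) (there (there f)) s≢v t≢v =
    contradiction (proj₁ (consec-∈ (z ∷ p) f)) (Unique[x∷xs]⇒x∉xs (unique-tail u))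
  skip-consec-v (x ∷ y ∷ p) u (there e) (there f) s≢v t≢v with x ≟ v | skip-consec-v (y ∷ p) (unique-tail u) e f s≢v t≢v
  ... | yes refl | g = g
  ... | no x≢v | g = consec-++⁺ʳ [ x ] g

consec-split : ∀ {A : Set} {s t} (p : List A) → (s , t) ∈ consec p → ∃₂ λ xs ys → p ≡ xs ++ s ∷ t ∷ ys
consec-split (x ∷ y ∷ p) (here refl) = [] , p , refl
consec-split (x ∷ y ∷ p) (there e) with consec-split (y ∷ p) e
... | xs , ys , f = x ∷ xs , ys , cong (x ∷_) f

consec-≢ : ∀ {A : Set} {s t} (p : List A) → Unique p → (s , t) ∈ consec p → s ≢ t
consec-≢ (x ∷ y ∷ p) u (here refl) refl = Unique[x∷xs]⇒x∉xs u (here refl)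
consec-≢ (x ∷ y ∷ p) u (there e) f = consec-≢ (y ∷ p) (unique-tail u) e f

-- By uniqueness the only edge at `a` leads to the second vertex, which is not the last one. This
-- separates the closing pair `ab` of `p`, read as a cycle, from the edges of the path `p`.
no-chord : ∀ {A : Set} {a b} (p : List A) → head p ≡ just a → last p ≡ just b → Unique p → 3 ≤ length p → ¬ Edge p a b
no-chord (_ ∷ _ ∷ []) h l u (s≤s (s≤s ())) e
no-chord (a ∷ x ∷ y ∷ p) refl l u _ (inj₁ (here refl)) =
  Unique[x∷xs]⇒x∉xs (unique-tail u) (last-∈ (y ∷ p) l)
no-chord (a ∷ x ∷ y ∷ p) refl l u _ (inj₁ (there e)) = Unique[x∷xs]⇒x∉xs u (proj₁ (consec-∈ (x ∷ y ∷ p) e))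
no-chord (a ∷ x ∷ y ∷ p) refl l u _ (inj₂ e) = Unique[x∷xs]⇒x∉xs u (consec-∈-tail (x ∷ y ∷ p) e)

link-≡ : ∀ {A : Set} {a b s t : A} (p : List A) → Link a b s t → Edge p s t → Edge p a b
link-≡ p (inj₁ (refl , refl)) e = e
link-≡ p (inj₂ (refl , refl)) e = swap e

last-∷ : ∀ {A : Set} {a b : A} (p : List A) → last p ≡ just b → last (a ∷ p) ≡ just b
last-∷ (x ∷ p) l = l

module Contraction {n} {G : Graph n} {v vs lsp} (S : PathSystem G (v ∷ vs) lsp) (v∉vs : v ∉ vs)
                   {a b} (D : Degree2 G v a b) (mid : lsp a b ≡ a ∷ v ∷ b ∷ []) where

  open Degree2 D
  open PathSystemProperties S
  open Skip v

  link? : ∀ i j → Dec (Link a b i j)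
  link? i j = (i ≟ a ×-dec j ≟ b) ⊎-dec (i ≟ b ×-dec j ≟ a)

  link-irr : ∀ {i} → ¬ Link a b i i
  link-irr (inj₁ (refl , refl)) = a≢b refl
  link-irr (inj₂ (refl , refl)) = a≢b refl

  open Minor G v {Link a b} link? link-sym link-irr public

  lsp′ : Fin n → Fin n → List (Fin n)
  lsp′ x y = skip (lsp x y)

  ≢v : ∀ {x} → x ∈ vs → x ≢ v
  ≢v x∈ refl = v∉vs x∈

  old : ∀ {x} → x ≢ v → x ∈ v ∷ vs → x ∈ vs
  old x≢v (here e) = contradiction e x≢v
  old x≢v (there x∈) = x∈

  a≢v : a ≢ v
  a≢v refl = adj-irrefl G va

  b≢v : b ≢ v
  b≢v refl = adj-irrefl G vb

  a∈ : a ∈ vs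
  a∈ = old a≢v (adj-∈ʳ va)

  b∈ : b ∈ vs
  b∈ = old b≢v (adj-∈ʳ vb)

  mid′ : lsp b a ≡ b ∷ v ∷ a ∷ []
  mid′ = trans (rev S (there a∈) (there b∈)) (cong reverse mid)

  -- Otherwise `lsp-infix` would make the two-vertex path the chosen one between `a` and `b`,
  -- against `mid`.
  link-not-consec : ∀ {x y s t} → x ∈ v ∷ vs → y ∈ v ∷ vs → Link a b s t → (s , t) ∉ consec (lsp x y)
  link-not-consec x∈ y∈ k e with consec-split _ e | k
  ... | xs , ys , f | inj₁ (refl , refl) with trans (sym mid) (lsp-infix xs [] x∈ y∈ f)
  ... | ()
  link-not-consec x∈ y∈ k e | xs , ys , f | inj₂ (refl , refl) with trans (sym mid′) (lsp-infix xs [] x∈ y∈ f)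
  ... | ()

  flank : ∀ {x y s t} → x ∈ v ∷ vs → y ∈ v ∷ vs →
    (s , v) ∈ consec (lsp x y) → (v , t) ∈ consec (lsp x y) → s ≢ t → Link a b s t
  flank x∈ y∈ e f = pair (adj-swap G (lsp-adj x∈ y∈ e)) (lsp-adj x∈ y∈ f)

  system : PathSystem G′ vs lsp′
  system = record { support = support′ ; isPath = isPath′ ; suffix = suffix″ ; rev = rev′ }
    where
    support′ : ∀ {x y} → Adj G′ x y → x ∈ vs
    support′ e with adj⇒ e
    ... | x≢v , _ , inj₁ f = old x≢v (support S f)
    ... | _ , _ , inj₂ (inj₁ (refl , _)) = a∈
    ... | _ , _ , inj₂ (inj₂ (refl , _)) = b∈
    isPath′ : ∀ {x y} → x ∈ vs → y ∈ vs → IsPath G′ x y (lsp′ x y)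
    isPath′ {x} {y} x∈ y∈ with isPath S (there x∈) (there y∈)
    ... | h , l , u , k = skip-head (lsp x y) h (≢v x∈) , skip-last (lsp x y) l (≢v y∈) , u′ , ⇒linked _ edge
      where
      u′ : Unique (lsp′ x y)
      u′ = filter⁺ (λ x → ¬? (x ≟ v)) u
      edge : ∀ {s t} → (s , t) ∈ consec (lsp′ x y) → Adj G′ s t
      edge e with consec-∈ (lsp′ x y) e
      ... | s∈ , t∈ = ⇒adj (proj₂ (skip-∈ (lsp x y) s∈) , proj₂ (skip-∈ (lsp x y) t∈) ,
        [ inj₁ ∘ linked⇒ k , (λ (f , g) → inj₂ (flank (there x∈) (there y∈) f g (consec-≢ _ u′ e))) ]′
          (skip-consec⇒ (lsp x y) u e))
    suffix″ : ∀ {x y z q} → x ∈ vs → y ∈ vs → lsp′ x y ≡ x ∷ z ∷ q → lsp′ z y ≡ z ∷ q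
    suffix″ {x} {y} {z} {q} x∈ y∈ e with lsp-head (there x∈) (there y∈)
    ... | r , f = go r f (∷-injectiveʳ (trans (sym (skip-≢ (≢v x∈))) (trans (cong skip (sym f)) e)))
      where
      step-to : ∀ {w r} → w ≢ v → lsp w y ≡ w ∷ r → skip (w ∷ r) ≡ z ∷ q → lsp′ z y ≡ z ∷ q
      step-to w≢v f e with ∷-injectiveˡ (trans (sym (skip-≢ w≢v)) e)
      ... | refl = trans (cong skip f) e
      go : ∀ r → lsp x y ≡ x ∷ r → skip r ≡ z ∷ q → lsp′ z y ≡ z ∷ q
      go (w ∷ r) f e with w ≟ v
      ... | no w≢v = step-to w≢v (suffix S (there x∈) (there y∈) f) (trans (skip-≢ w≢v) e)
      -- The first step of the contracted path stands for two steps through `v`, so `suffix` is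
      -- applied twice.
      go (.v ∷ t ∷ r) f e | yes refl = step-to t≢v (suffix S (here refl) (there y∈) vy) e
        where
        vy : lsp v y ≡ v ∷ t ∷ r
        vy = suffix S (there x∈) (there y∈) f
        t≢v : t ≢ v
        t≢v refl = Unique[x∷xs]⇒x∉xs (subst Unique vy (proj₁ (proj₂ (proj₂ (isPath S (here refl) (there y∈)))))) (here refl)
    rev′ : ∀ {x y} → x ∈ vs → y ∈ vs → lsp′ y x ≡ reverse (lsp′ x y)
    rev′ {x} {y} x∈ y∈ = trans (cong skip (rev S (there x∈) (there y∈))) (skip-reverse (lsp x y))

  module S′ = PathSystemProperties system

  -- Undoing the contraction: c′ is kept if it avoids the pair ab, and otherwise
  -- the pair ab is subdivided by v.
  data Expands (c′ c : List (Fin n)) : Set where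
    kept : v ∉ c → ¬ CycEdge c′ a b → SameCycle c′ c → Expands c′ c
    subdivided : ∀ p → head p ≡ just a → last p ≡ just b → v ∉ p → Unique p → 3 ≤ length p →
      SameCycle c′ p → SameCycle c (v ∷ p) → Expands c′ c

  ring-ab : ∀ p → head p ≡ just a → last p ≡ just b → CycEdge p a b
  ring-ab p h l = ring⇐ p h l (inj₂ (inj₁ (refl , refl)))

  -- An edge of `p` that `q` used as its closing pair would be the pair `ab`, which `no-chord`
  -- excludes for `p`. So it is a path edge of `q` and survives the subdivision.
  ring⇒cone : ∀ p q → head p ≡ just a → last p ≡ just b → head q ≡ just a → last q ≡ just b →
    Unique p → 3 ≤ length p → (∀ i j → CycEdge p i j → CycEdge q i j) → ∀ i j → CycEdge (v ∷ p) i j → CycEdge (v ∷ q) i j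
  ring⇒cone p q hp lp hq lq u three f i j e with cone⇒ p hp lp e
  ... | inj₂ r = cone⇐ q hq lq (inj₂ r)
  ... | inj₁ r with ring⇒ q hq lq (f i j (ring⇐ p hp lp (inj₁ r)))
  ... | inj₁ r′ = cone⇐ q hq lq (inj₁ r′)
  ... | inj₂ k = contradiction (link-≡ p k r) (no-chord p hp lp u three)

  cone⇒ring : ∀ p q → head p ≡ just a → last p ≡ just b → head q ≡ just a → last q ≡ just b →
    v ∉ p → (∀ i j → CycEdge (v ∷ p) i j → CycEdge (v ∷ q) i j) → ∀ i j → CycEdge p i j → CycEdge q i j
  cone⇒ring p q hp lp hq lq v∉ f i j e with ring⇒ p hp lp e
  ... | inj₂ k = ring⇐ q hq lq (inj₂ k)
  ... | inj₁ r with edge-∈ p r | cone⇒ q hq lq (f i j (cone⇐ p hp lp (inj₁ r)))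
  ... | _ | inj₁ r′ = ring⇐ q hq lq (inj₁ r′)
  ... | i∈ , _ | inj₂ (inj₁ (inj₁ (refl , _))) = contradiction i∈ v∉
  ... | _ , j∈ | inj₂ (inj₁ (inj₂ (_ , refl))) = contradiction j∈ v∉
  ... | i∈ , _ | inj₂ (inj₂ (inj₁ (refl , _))) = contradiction i∈ v∉
  ... | _ , j∈ | inj₂ (inj₂ (inj₂ (_ , refl))) = contradiction j∈ v∉

  -- In the mixed cases exactly one of `c` and `d` contains `v`; in the converse `expands-⇐`,
  -- exactly one of `c′` and `d′` uses the pair `ab`. Together they let distinctness and
  -- completeness of a list of cycles pass through the expansion.
  expands-⇒ : ∀ {c′ c d′ d} → Expands c′ c → Expands d′ d → SameCycle c d → SameCycle c′ d′
  expands-⇒ {c′} {c} {d′} {d} (kept _ _ f) (kept _ _ g) same =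
    same-trans {c = c′} {c} {d′} f (same-trans {c = c} {d} {d′} same (same-sym {c = d′} {d} g))
  expands-⇒ {c = c} {d = d} (kept v∉ _ f) (subdivided p _ _ _ _ _ _ g) same =
    contradiction (same-∈ {c = v ∷ p} {c} (same-sym {c = c} {v ∷ p} (same-trans {c = c} {d} {v ∷ p} same g)) (here refl)) v∉
  expands-⇒ {c = c} {d = d} (subdivided p _ _ _ _ _ _ g) (kept v∉ _ f) same =
    contradiction (same-∈ {c = v ∷ p} {d} (same-trans {c = v ∷ p} {c} {d} (same-sym {c = c} {v ∷ p} g) same) (here refl)) v∉
  expands-⇒ {c′} {c} {d′} {d} (subdivided p hp lp v∉p _ _ f g) (subdivided q hq lq v∉q _ _ f′ g′) same =
    same-trans {c = c′} {p} {d′} f (same-trans {c = p} {q} {d′} pq (same-sym {c = d′} {q} f′))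
    where
    cones : SameCycle (v ∷ p) (v ∷ q)
    cones = same-trans {c = v ∷ p} {c} {v ∷ q} (same-sym {c = c} {v ∷ p} g) (same-trans {c = c} {d} {v ∷ q} same g′)
    pq : SameCycle p q
    pq i j = cone⇒ring p q hp lp hq lq v∉p (λ i j → proj₁ (cones i j)) i j ,
             cone⇒ring q p hq lq hp lp v∉q (λ i j → proj₂ (cones i j)) i j

  expands-⇐ : ∀ {c′ c d′ d} → Expands c′ c → Expands d′ d → SameCycle c′ d′ → SameCycle c d
  expands-⇐ {c′} {c} {d′} {d} (kept _ _ f) (kept _ _ g) same =
    same-trans {c = c} {c′} {d} (same-sym {c = c′} {c} f) (same-trans {c = c′} {d′} {d} same g)
  expands-⇐ (kept _ ¬ab f) (subdivided p h l _ _ _ g _) same =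
    contradiction (proj₂ (same a b) (proj₂ (g a b) (ring-ab p h l))) ¬ab
  expands-⇐ (subdivided p h l _ _ _ g _) (kept _ ¬ab f) same =
    contradiction (proj₁ (same a b) (proj₂ (g a b) (ring-ab p h l))) ¬ab
  expands-⇐ {c′} {c} {d′} {d} (subdivided p hp lp _ up tp f g) (subdivided q hq lq _ uq tq f′ g′) same =
    same-trans {c = c} {v ∷ p} {d} g (same-trans {c = v ∷ p} {v ∷ q} {d} cones (same-sym {c = d} {v ∷ q} g′))
    where
    pq : SameCycle p q
    pq = same-trans {c = p} {c′} {q} (same-sym {c = c′} {p} f) (same-trans {c = c′} {d′} {q} same f′)
    cones : SameCycle (v ∷ p) (v ∷ q)
    cones i j = ring⇒cone p q hp lp hq lq up tp (λ i j → proj₁ (pq i j)) i j ,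
                ring⇒cone q p hq lq hp lp uq tq (λ i j → proj₂ (pq i j)) i j

  -- Once `a` is rotated to the front, `ab` is either the closing pair, as wanted, or the first
  -- step; in the latter case reversing everything behind `a` moves `b` to the end.
  open-at-ab : ∀ {C} → IsCycle G′ C → CycEdge C a b →
    ∃ λ p → head p ≡ just a × last p ≡ just b × SameCycle C p × IsCycle G′ p
  open-at-ab {C} cyc e with rotate G′ cyc (cyc-∈ C e)
  ... | [] , same , (s≤s () , _)
  ... | x ∷ q , same , cyc′@(_ , u , _) with nonempty-last x q
  ... | t , l with cone⇒ (x ∷ q) refl l (proj₁ (same a b) e)
  ... | inj₁ f = contradiction (proj₁ (edge-∈ (x ∷ q) f)) (Unique[x∷xs]⇒x∉xs u)
  ... | inj₂ (inj₁ (inj₂ (_ , f))) = contradiction (sym f) a≢b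
  ... | inj₂ (inj₂ (inj₂ (_ , f))) = contradiction (sym f) a≢b
  ... | inj₂ (inj₂ (inj₁ (_ , refl))) = a ∷ x ∷ q , refl , l , same , cyc′
  ... | inj₂ (inj₁ (inj₁ (_ , refl))) = a ∷ reverse (b ∷ q) , refl ,
        last-∷ (reverse (b ∷ q)) (last-reverse (b ∷ q)) ,
        same-trans {c = C} {a ∷ b ∷ q} {a ∷ reverse (b ∷ q)} same (same-flip a (b ∷ q)) , flip-cycle G′ cyc′

  expand : ∀ {C} → Short G′ lsp′ C → ∃ λ D → Short G lsp D × Expands C D
  expand {C} sh@(cyc , f) with ((a , b) ∈? consec (close C)) ⊎-dec ((b , a) ∈? consec (close C))
    where open DecMem (≡-dec (_≟_ {n}) (_≟_ {n})) using (_∈?_)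
  ... | no ¬ab = C , (down cyc (λ e k → ¬ab (link-resp (CycEdge C) (cyc-sym C) e (unlink k))) , convex) ,
      kept (avoids cyc) ¬ab (same-refl {c = C})
    where
    unlink : ∀ {s t} → Link a b s t → Link s t a b
    unlink (inj₁ (refl , refl)) = inj₁ (refl , refl)
    unlink (inj₂ (refl , refl)) = inj₂ (refl , refl)
    convex : ∀ x y → x ∈ C → y ∈ C → PathInCycle (lsp x y) C
    convex x y x∈ y∈ = subst (λ r → PathInCycle r C) (skip-∉ v∉) (f x y x∈ y∈)
      where
      x∈vs = S′.cycle-∈ {C = C} cyc x∈
      y∈vs = S′.cycle-∈ {C = C} cyc y∈
      v∉ : v ∉ lsp x y
      -- A chosen path through `v` becomes, after skipping, a chosen path that uses the pair `ab`,
      -- and then `C` would use it too.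
      v∉ v∈ with through (there x∈vs) (there y∈vs) (≢v x∈vs) (≢v y∈vs) v∈
      ... | s , t , sv , vt , s≢t , _ = ¬ab (link-resp (CycEdge C) (cyc-sym C) st
              (unlink k))
        where
        k = flank (there x∈vs) (there y∈vs) sv vt s≢t
        st : CycEdge C s t
        st = proj₂ (f x y x∈ y∈) s t (skip-consec-v (lsp x y)
               (proj₁ (proj₂ (proj₂ (isPath S (there x∈vs) (there y∈vs))))) sv vt
               (λ { refl → adj-irrefl G (lsp-adj (there x∈vs) (there y∈vs) sv) })
               (λ { refl → adj-irrefl G (lsp-adj (there x∈vs) (there y∈vs) vt) }))
  ... | yes ab with open-at-ab cyc ab
  ... | p , h , l , same , cyc′@(three , u , k) = v ∷ p , cone-short (here refl) nbrs h l cone-cycle convex ,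
      subdivided p h l v∉p u three same (same-refl {c = v ∷ p})
    where
    v∉p = avoids cyc′
    convex′ = proj₂ (S′.short-same {C = C} {p} cyc′ same sh)
    cone-cycle : IsCycle G (v ∷ p)
    cone-cycle = ≤-trans three (n≤1+n _) , ¬Any⇒All¬ p v∉p ∷ u , linked-cyc (v ∷ p) λ e → edge (cone⇒ p h l e)
      where
      edge : ∀ {i j} → Edge p i j ⊎ Link v a i j ⊎ Link v b i j → Adj G i j
      edge (inj₁ e) with adj⇒ (cyc-linked (adj-swap G′) p k (ring⇐ p h l (inj₁ e)))
      ... | _ , _ , inj₁ g = g
      ... | _ , _ , inj₂ m = contradiction (link-≡ p m e) (no-chord p h l u three)
      edge (inj₂ (inj₁ e)) = link-resp (Adj G) (adj-swap G) va e
      edge (inj₂ (inj₂ e)) = link-resp (Adj G) (adj-swap G) vb e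
    at-v : ∀ {t} → Adj G v t → CycEdge (v ∷ p) v t
    at-v e = cone⇐ p h l (inj₂ ([ (λ g → inj₁ (inj₁ (refl , g))) , (λ g → inj₂ (inj₁ (refl , g))) ]′ (nbrs e)))
    convex : ∀ x y → x ∈ p → y ∈ p → PathInCycle (lsp x y) (v ∷ p)
    convex x y x∈ y∈ = vertex , edge
      where
      x∈vs = there (S′.cycle-∈ {C = p} cyc′ x∈)
      y∈vs = there (S′.cycle-∈ {C = p} cyc′ y∈)
      vertex : ∀ i → i ∈ lsp x y → i ∈ v ∷ p
      vertex i i∈ with i ≟ v
      ... | yes refl = here refl
      ... | no i≢v = there (proj₁ (convex′ x y x∈ y∈) i (∈-skip i∈ i≢v))
      edge : ∀ s t → (s , t) ∈ consec (lsp x y) → CycEdge (v ∷ p) s t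
      edge s t e with s ≟ v | t ≟ v
      ... | yes refl | _ = at-v (lsp-adj x∈vs y∈vs e)
      ... | no _ | yes refl = cyc-sym (v ∷ p) (at-v (adj-swap G (lsp-adj x∈vs y∈vs e)))
      ... | no s≢v | no t≢v with ring⇒ p h l (proj₂ (convex′ x y x∈ y∈) s t (skip-consec⇐ (lsp x y) e s≢v t≢v))
      ... | inj₁ g = cone⇐ p h l (inj₁ g)
      -- The only edge of the cycle `p` that is lost in `v ∷ p` is `ab`, and no chosen path of `G`
      -- uses it.
      ... | inj₂ m = contradiction e (link-not-consec x∈vs y∈vs m)

  triangle : List (Fin n)
  triangle = v ∷ a ∷ b ∷ []

  -- A short cycle avoiding `v` cannot use `ab`, since it would contain the chosen path `a v b`. One
  -- through `v` reads `v ∷ p`, and `p` closes up to a cycle of `G′` unless it has no inner vertex;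
  -- that exception is the triangle.
  shrink : ∀ {C} → Short G lsp C → (SameCycle C triangle × Adj G a b) ⊎ (∃ λ D → Short G′ lsp′ D × Expands D C)
  shrink {C} sh@(cyc , f) with v ∈? C
    where open DecMem (_≟_ {n}) using (_∈?_)
  ... | no v∉ = inj₂ (C , (up cyc v∉ , convex) , kept v∉ ¬ab (same-refl {c = C}))
    where
    convex : ∀ x y → x ∈ C → y ∈ C → PathInCycle (lsp′ x y) C
    convex x y x∈ y∈ = subst (λ r → PathInCycle r C)
      (sym (skip-∉ (λ v∈ → v∉ (proj₁ (f x y x∈ y∈) v v∈)))) (f x y x∈ y∈)
    ¬ab : ¬ CycEdge C a b
    ¬ab e = v∉ (proj₁ (f a b (cyc-∈ C e) (cyc-∈ C (cyc-sym C e))) v (subst (v ∈_) (sym mid) (there (here refl))))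
  ... | yes v∈ with apex G D cyc v∈
  ... | p , h , l , same , cyc′ = go p h l same cyc′ (short-same {C = C} {v ∷ p} cyc′ same sh)
    where
    go : ∀ p → head p ≡ just a → last p ≡ just b → SameCycle C (v ∷ p) → IsCycle G (v ∷ p) → Short G lsp (v ∷ p) →
      (SameCycle C triangle × Adj G a b) ⊎ (∃ λ D → Short G′ lsp′ D × Expands D C)
    go (x ∷ []) refl refl _ _ _ = contradiction refl a≢b
    go (x ∷ y ∷ []) refl refl same (_ , _ , _ ∷ k ∷ _) _ = inj₁ (same , k)
    go p@(_ ∷ _ ∷ _ ∷ _) h l same (_ , uv@(_ ∷ u) , k) (_ , g) =
      inj₂ (p , (cyc″ , λ x y x∈ y∈ → vertex x y x∈ y∈ , edge x y x∈ y∈) ,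
            subdivided p h l v∉p u three (same-refl {c = p}) same)
      where
      three : 3 ≤ length p
      three = s≤s (s≤s (s≤s z≤n))
      v∉p : v ∉ p
      v∉p = Unique[x∷xs]⇒x∉xs uv
      cyc″ : IsCycle G′ p
      cyc″ = three , u , linked-cyc p λ e → on-edge (ring⇒ p h l e)
        where
        on-edge : ∀ {i j} → Edge p i j ⊎ Link a b i j → Adj G′ i j
        on-edge (inj₁ e) with edge-∈ p e
        ... | i∈ , j∈ = ⇒adj ((λ { refl → v∉p i∈ }) , (λ { refl → v∉p j∈ }) ,
                          inj₁ (cyc-linked (adj-swap G) (v ∷ p) k (cone⇐ p h l (inj₁ e))))
        on-edge (inj₂ m) = link-resp (Adj G′) (adj-swap G′) (⇒adj (a≢v , b≢v , inj₂ (inj₁ (refl , refl)))) m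
      vertex : ∀ x y → x ∈ p → y ∈ p → ∀ i → i ∈ lsp′ x y → i ∈ p
      vertex x y x∈ y∈ i i∈ with skip-∈ (lsp x y) i∈
      ... | i∈′ , i≢v with proj₁ (g x y (there x∈) (there y∈)) i i∈′
      ... | here e = contradiction e i≢v
      ... | there r = r
      edge : ∀ x y → x ∈ p → y ∈ p → ∀ s t → (s , t) ∈ consec (lsp′ x y) → CycEdge p s t
      edge x y x∈ y∈ s t e
        with skip-consec⇒ (lsp x y) (proj₁ (proj₂ (proj₂ (isPath S x∈ws y∈ws)))) e
        where
        x∈ws = there (S′.cycle-∈ {C = p} cyc″ x∈)
        y∈ws = there (S′.cycle-∈ {C = p} cyc″ y∈)
      -- A pair that became consecutive by skipping `v` is `ab`, the closing pair of `p`.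
      ... | inj₂ (sv , vt) = ring⇐ p h l (inj₂ (flank x∈ws y∈ws sv vt
                               (λ { refl → adj-irrefl G′ (linked⇒ (proj₂ (proj₂ (proj₂ path′))) e) })))
        where
        x∈ws = there (S′.cycle-∈ {C = p} cyc″ x∈)
        y∈ws = there (S′.cycle-∈ {C = p} cyc″ y∈)
        path′ = isPath system (S′.cycle-∈ {C = p} cyc″ x∈) (S′.cycle-∈ {C = p} cyc″ y∈)
      ... | inj₁ st with cone⇒ p h l (proj₂ (g x y (there x∈) (there y∈)) s t st)
      ... | inj₁ r = ring⇐ p h l (inj₁ r)
      ... | inj₂ r = ⊥-elim ([ at , at ]′ r)
        where
        ends = consec-∈ (lsp′ x y) e
        at : ∀ {w} → ¬ Link v w s t
        at (inj₁ (refl , _)) = proj₂ (skip-∈ (lsp x y) (proj₁ ends)) refl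
        at (inj₂ (_ , refl)) = proj₂ (skip-∈ (lsp x y) (proj₂ ends)) refl

  triangle-short : Adj G a b → Short G lsp triangle
  triangle-short ab = cone-short (here refl) nbrs refl refl cyc convex
    where
    cyc : IsCycle G triangle
    cyc = s≤s (s≤s (s≤s z≤n)) , ((≢-sym a≢v ∷ ≢-sym b≢v ∷ []) ∷ (a≢b ∷ []) ∷ [] ∷ []) ,
          va ∷ ab ∷ adj-swap G vb ∷ [-]
    path : PathInCycle (a ∷ v ∷ b ∷ []) triangle
    path = (λ { _ (here e) → there (here e) ; _ (there (here e)) → here e ; _ (there (there (here e))) → there (there (here e)) }) ,
           (λ { _ _ (here refl) → inj₂ (here refl) ; _ _ (there (here refl)) → inj₂ (there (there (here refl))) })
    convex : ∀ x y → x ∈ a ∷ b ∷ [] → y ∈ a ∷ b ∷ [] → PathInCycle (lsp x y) triangle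
    convex _ _ (here refl) (here refl) rewrite trivial (there a∈) = (λ { _ (here refl) → there (here refl) }) , λ _ _ ()
    convex _ _ (here refl) (there (here refl)) rewrite mid = path
    convex _ _ (there (here refl)) (here refl) rewrite mid′ = pathIn-reverse (a ∷ v ∷ b ∷ []) path
    convex _ _ (there (here refl)) (there (here refl)) rewrite trivial (there b∈) =
      (λ { _ (here refl) → there (there (here refl)) }) , λ _ _ ()

  -- The triangle has both the vertex `v` and the edge `ab`; a kept cycle misses `v`, and a
  -- subdivided one misses `ab` by `no-chord`.
  triangle-new : ∀ {C D} → Expands C D → ¬ SameCycle triangle D
  triangle-new {D = D} (kept v∉ _ _) same = v∉ (same-∈ {c = triangle} {D} same (here refl))
  triangle-new (subdivided p h l v∉ u three _ g) same
    with cone⇒ p h l (proj₁ (g a b) (proj₁ (same a b) (inj₁ (there (here refl)))))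
  ... | inj₁ e = no-chord p h l u three e
  ... | inj₂ (inj₁ (inj₁ (e , _))) = a≢v e
  ... | inj₂ (inj₁ (inj₂ (_ , e))) = b≢v e
  ... | inj₂ (inj₂ (inj₁ (e , _))) = a≢v e
  ... | inj₂ (inj₂ (inj₂ (_ , e))) = b≢v e

  expand-all : ∀ {L} → All (Short G′ lsp′) L → ∃ λ M → All (Short G lsp) M × Pointwise Expands L M
  expand-all [] = [] , [] , []
  expand-all (sh ∷ shs) with expand sh | expand-all shs
  ... | D , sh′ , e | M , shs′ , es = D ∷ M , sh′ ∷ shs′ , e ∷ es

  expands-distinct : ∀ {L M} → Pointwise Expands L M → AllPairs (λ c d → ¬ SameCycle c d) L →
    AllPairs (λ c d → ¬ SameCycle c d) M
  expands-distinct [] [] = []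
  expands-distinct (e ∷ es) (d ∷ ds) = one e es d ∷ expands-distinct es ds
    where
    one : ∀ {c′ c L M} → Expands c′ c → Pointwise Expands L M → All (λ d → ¬ SameCycle c′ d) L → All (λ d → ¬ SameCycle c d) M
    one e [] [] = []
    one e (f ∷ fs) (d ∷ ds) = d ∘ expands-⇒ e f ∷ one e fs ds

  expands-any : ∀ {c′ c L M} → Expands c′ c → Pointwise Expands L M → Any (SameCycle c′) L → Any (SameCycle c) M
  expands-any e (f ∷ fs) (here g) = here (expands-⇐ e f g)
  expands-any e (f ∷ fs) (there g) = there (expands-any e fs g)

  enumerates-subdivide : ∀ {L} → ¬ Adj G a b → Enumerates G′ lsp′ L →
    ∃ λ M → length L ≡ length M × Enumerates G lsp M
  enumerates-subdivide ¬ab (all , distinct , complete) with expand-all all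
  ... | M , all′ , es = M , Pointwise-length es , all′ , expands-distinct es distinct , λ C sh →
    [ (λ (_ , ab) → contradiction ab ¬ab) , (λ (D , sh′ , e) → expands-any e es (complete D sh′)) ]′ (shrink sh)

  enumerates-triangle : ∀ {L} → Adj G a b → Enumerates G′ lsp′ L →
    ∃ λ M → suc (length L) ≡ length M × Enumerates G lsp M
  enumerates-triangle ab (all , distinct , complete) with expand-all all
  ... | M , all′ , es = triangle ∷ M , cong suc (Pointwise-length es) , triangle-short ab ∷ all′ ,
    new es ∷ expands-distinct es distinct , λ C sh →
    [ here ∘ proj₁ , (λ (D , sh′ , e) → there (expands-any e es (complete D sh′))) ]′ (shrink sh)
    where
    new : ∀ {L M} → Pointwise Expands L M → All (λ d → ¬ SameCycle triangle d) M
    new [] = []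
    new (e ∷ es) = triangle-new e ∷ new es

-- Edge counts

bit : Bool → ℕ
bit false = 0
bit true = 1

count : ∀ {A : Set} → (A → Bool) → List A → ℕ
count p [] = 0
count p (x ∷ xs) = bit (p x) + count p xs

length-filterᵇ : ∀ {A : Set} (p : A → Bool) xs → length (filterᵇ p xs) ≡ count p xs
length-filterᵇ p [] = refl
length-filterᵇ p (x ∷ xs) with p x
... | true = cong suc (length-filterᵇ p xs)
... | false = length-filterᵇ p xs

count-cong : ∀ {A : Set} {p q : A → Bool} xs → (∀ {x} → x ∈ xs → p x ≡ q x) → count p xs ≡ count q xs
count-cong [] f = refl
count-cong (x ∷ xs) f = cong₂ _+_ (cong bit (f (here refl))) (count-cong xs (f ∘ there))

count-none : ∀ {A : Set} {p : A → Bool} xs → (∀ {x} → x ∈ xs → p x ≡ false) → count p xs ≡ 0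
count-none [] f = refl
count-none (x ∷ xs) f = cong₂ _+_ (cong bit (f (here refl))) (count-none xs (f ∘ there))

count-++ : ∀ {A : Set} (p : A → Bool) xs ys → count p (xs ++ ys) ≡ count p xs + count p ys
count-++ p [] ys = refl
count-++ p (x ∷ xs) ys = trans (cong (bit (p x) +_) (count-++ p xs ys)) (sym (+-assoc (bit (p x)) _ _))

count-map : ∀ {A B : Set} (p : B → Bool) (f : A → B) xs → count p (map f xs) ≡ count (p ∘ f) xs
count-map p f [] = refl
count-map p f (x ∷ xs) = cong (bit (p (f x)) +_) (count-map p f xs)

exchange : ∀ x y z → x + (y + z) ≡ y + (x + z)
exchange = solve-∀

count-↭ : ∀ {A : Set} (p : A → Bool) {xs ys} → xs ↭ ys → count p xs ≡ count p ys
count-↭ p Perm.refl = refl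
count-↭ p (prep x r) = cong (bit (p x) +_) (count-↭ p r)
count-↭ p (Perm.swap x y r) = trans (exchange (bit (p x)) (bit (p y)) _)
  (cong (λ k → bit (p y) + (bit (p x) + k)) (count-↭ p r))
count-↭ p (Perm.trans r s) = trans (count-↭ p r) (count-↭ p s)

count-add : ∀ {A : Set} {p q : A → Bool} {b} xs → Unique xs → b ∈ xs → p b ≡ false → q b ≡ true →
  (∀ {x} → x ∈ xs → x ≢ b → q x ≡ p x) → count q xs ≡ suc (count p xs)
count-add {p = p} {q} (x ∷ xs) u (here refl) pb qb f rewrite pb | qb =
  cong suc (count-cong xs λ y∈ → f (there y∈) (λ { refl → Unique[x∷xs]⇒x∉xs u y∈ }))
count-add {p = p} {q} (x ∷ xs) u (there b∈) pb qb f
  rewrite f (here refl) (λ { refl → Unique[x∷xs]⇒x∉xs u b∈ }) =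
  trans (cong (bit (p x) +_) (count-add {p = p} xs (unique-tail u) b∈ pb qb (f ∘ there))) (+-suc (bit (p x)) _)

≡-fromIff : ∀ {x y : Bool} → (x ≡ true → y ≡ true) → (y ≡ true → x ≡ true) → x ≡ y
≡-fromIff {false} {false} f g = refl
≡-fromIff {false} {true} f g = g refl
≡-fromIff {true} f g = sym (f refl)

module _ {n : ℕ} where

  -- Each edge is counted at its earlier end in the list, so taking `v` off the front subtracts
  -- exactly the number of its neighbours in `vs`.
  edges : Graph n → List (Fin n) → ℕ
  edges G [] = 0
  edges G (v ∷ vs) = count (adj G v) vs + edges G vs

  edges-cong : ∀ (G H : Graph n) vs → (∀ {x y} → x ∈ vs → y ∈ vs → adj G x y ≡ adj H x y) → edges G vs ≡ edges H vs
  edges-cong G H [] f = refl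
  edges-cong G H (v ∷ vs) f = cong₂ _+_ (count-cong vs (f (here refl) ∘ there))
    (edges-cong G H vs (λ x∈ y∈ → f (there x∈) (there y∈)))

  edges-↭ : ∀ (G : Graph n) {us vs} → us ↭ vs → edges G us ≡ edges G vs
  edges-↭ G Perm.refl = refl
  edges-↭ G (prep x r) = cong₂ _+_ (count-↭ (adj G x) r) (edges-↭ G r)
  edges-↭ G (Perm.swap {xs} {ys} x y r) rewrite adj-sym G x y =
    trans (shuffle (bit (adj G y x)) (count (adj G x) xs) _ _)
      (cong₂ (λ k l → bit (adj G y x) + k + l) (count-↭ (adj G y) r)
        (cong₂ _+_ (count-↭ (adj G x) r) (edges-↭ G r)))
    where
    shuffle : ∀ b c d e → b + c + (d + e) ≡ b + d + (c + e)
    shuffle = solve-∀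
  edges-↭ G (Perm.trans r s) = trans (edges-↭ G r) (edges-↭ G s)

  edges-add : ∀ (G H : Graph n) {a b} vs → Unique vs → a ∈ vs → b ∈ vs → a ≢ b → ¬ Adj G a b → Adj H a b →
    (∀ {x y} → x ∈ vs → y ∈ vs → ¬ Link a b x y → adj H x y ≡ adj G x y) →
    edges H vs ≡ suc (edges G vs)
  edges-add G H (v ∷ vs) u (here refl) (here refl) a≢b ¬g h f = contradiction refl a≢b
  edges-add G H (v ∷ vs) u (here refl) (there b∈) a≢b ¬g h f =
    cong₂ _+_ (count-add vs (unique-tail u) b∈ (Bool.¬-not ¬g) h
                 (λ y∈ y≢b → f (here refl) (there y∈)
                   λ { (inj₁ (_ , e)) → y≢b e ; (inj₂ (e , _)) → a≢b e }))
      (edges-cong H G vs (λ x∈ y∈ → f (there x∈) (there y∈)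
        λ { (inj₁ (refl , _)) → Unique[x∷xs]⇒x∉xs u x∈ ; (inj₂ (_ , refl)) → Unique[x∷xs]⇒x∉xs u y∈ }))
  edges-add G H (v ∷ vs) u (there a∈) (here refl) a≢b ¬g h f =
    edges-add G H (v ∷ vs) u (here refl) (there a∈) (≢-sym a≢b) (¬g ∘ adj-swap G) (adj-swap H h)
      (λ x∈ y∈ ¬k → f x∈ y∈ (¬k ∘ link-flip))
  edges-add G H {a} {b} (v ∷ vs) u (there a∈) (there b∈) a≢b ¬g h f =
    trans (cong₂ _+_ (count-cong vs (λ y∈ → f (here refl) (there y∈)
        λ { (inj₁ (refl , _)) → Unique[x∷xs]⇒x∉xs u a∈ ; (inj₂ (refl , _)) → Unique[x∷xs]⇒x∉xs u b∈ }))
      (edges-add G H vs (unique-tail u) a∈ b∈ a≢b ¬g h (λ x∈ y∈ → f (there x∈) (there y∈))))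
      (+-suc _ _)

  -- The columns stay the full list while the rows are used up, hence `pre`: its vertices lie below
  -- every remaining row and fail the test `<`.
  edges-product : ∀ (G : Graph n) pre xs → (∀ {x y} → y ∈ pre → x ∈ xs → y <ᶠ x) → AllPairs _<ᶠ_ xs →
    count (λ p → ⌊ proj₁ p <ᶠ? proj₂ p ⌋ ∧ adj G (proj₁ p) (proj₂ p)) (cartesianProduct xs (pre ++ xs)) ≡ edges G xs
  edges-product G pre [] below sorted = refl
  edges-product G pre (x ∷ xs) below (x< ∷ sorted) =
    trans (count-++ P (map (x ,_) (pre ++ x ∷ xs)) _)
      (cong₂ _+_
        (trans (count-map P (x ,_) (pre ++ x ∷ xs)) (trans (count-++ (P ∘ (x ,_)) pre (x ∷ xs))
          (cong₂ _+_ (count-none pre (λ y∈ → not-below (<-asym (below y∈ (here refl)))))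
            (cong₂ _+_ (cong bit (not-below (<ᶠ-irrefl refl)))
              (count-cong xs (λ y∈ → cong (_∧ adj G x _) (⇒⌊⌋ (x <ᶠ? _) (All.lookup x< y∈))))))))
        (trans (cong (λ l → count P (cartesianProduct xs l)) (sym (++-assoc pre [ x ] xs)))
          (edges-product G (pre ++ [ x ]) xs below′ sorted)))
    where
    P : Fin n × Fin n → Bool
    P p = ⌊ proj₁ p <ᶠ? proj₂ p ⌋ ∧ adj G (proj₁ p) (proj₂ p)
    not-below : ∀ {y} → ¬ x <ᶠ y → P (x , y) ≡ false
    not-below {y} ¬< with x <ᶠ? y
    ... | yes lt = contradiction lt ¬<
    ... | no _ = refl
    below′ : ∀ {z y} → y ∈ pre ++ [ x ] → z ∈ xs → y <ᶠ z
    below′ y∈ z∈ with ∈-++⁻ pre y∈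
    ... | inj₁ y∈pre = below y∈pre (there z∈)
    ... | inj₂ (here refl) = All.lookup x< z∈

  edgeCount-edges : ∀ (G : Graph n) → edgeCount G ≡ edges G (allFin n)
  edgeCount-edges G = trans (length-filterᵇ _ (cartesianProduct (allFin n) (allFin n)))
    (edges-product G [] (allFin n) (λ ()) (tabulate⁺-< id))

-- Elimination orders

-- A perfect elimination order of width at most two.
data Elim {V : Set} (R : V → V → Set) : List V → Set where
  []   : Elim R []
  step : ∀ {v vs} → v ∉ vs →
    (∀ {x y} → x ∈ vs → y ∈ vs → x ≢ y → R v x → R v y → R x y) →
    (∀ {x y z} → x ∈ vs → y ∈ vs → z ∈ vs → R v x → R v y → R v z → x ≡ y ⊎ x ≡ z ⊎ y ≡ z) →
    Elim R vs → Elim R (v ∷ vs)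

elim-unique : ∀ {V : Set} {R : V → V → Set} {vs} → Elim R vs → Unique vs
elim-unique [] = []
elim-unique (step v∉ _ _ e) = ¬Any⇒All¬ _ v∉ ∷ elim-unique e

-- `extend` numbers the new vertex `zero`, so increasing indices list a 2-tree in reverse order of
-- insertion. These are the two conditions an elimination step asks of the vertex `zero`.
record Simplicial {k} (T : Fin (suc k) → Fin (suc k) → Bool) : Set where
  field
    clique : ∀ i j → i ≢ j → T zero (suc i) ≡ true → T zero (suc j) ≡ true → T (suc i) (suc j) ≡ true
    width  : ∀ i j l → T zero (suc i) ≡ true → T zero (suc j) ≡ true → T zero (suc l) ≡ true → i ≡ j ⊎ i ≡ l ⊎ j ≡ l

module _ {V : Set} where

  -- `g` is a partial labelling of the 2-tree by `V`. Dropping the unlabelled vertices keeps an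
  -- elimination order, because the clique and width conditions pass to induced subgraphs.
  collect : ∀ {k} → (Fin k → Maybe V) → List V
  collect g = catMaybes (tabulate g)

  ∈-collect⁻ : ∀ {k} (g : Fin k → Maybe V) {x} → x ∈ collect g → ∃ λ i → g i ≡ just x
  ∈-collect⁻ {suc k} g x∈ with g zero in eq | x∈
  ... | just v | here refl = zero , eq
  ... | just v | there x∈′ = let i , e = ∈-collect⁻ (g ∘ suc) x∈′ in suc i , e
  ... | nothing | x∈′ = let i , e = ∈-collect⁻ (g ∘ suc) x∈′ in suc i , e

  ∈-collect⁺ : ∀ {k} (g : Fin k → Maybe V) {x} i → g i ≡ just x → x ∈ collect g
  ∈-collect⁺ g zero e rewrite e = here refl
  ∈-collect⁺ g (suc i) e with g zero
  ... | just v = there (∈-collect⁺ (g ∘ suc) i e)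
  ... | nothing = ∈-collect⁺ (g ∘ suc) i e

  record Represents {k} (g : Fin k → Maybe V) (T : Fin k → Fin k → Bool) (R : V → V → Set) : Set where
    field
      inj : ∀ {i j x} → g i ≡ just x → g j ≡ just x → i ≡ j
      to  : ∀ {i j x y} → g i ≡ just x → g j ≡ just y → R x y → T i j ≡ true
      from : ∀ {i j x y} → g i ≡ just x → g j ≡ just y → T i j ≡ true → R x y

  restrict : ∀ {k} {g : Fin (suc k) → Maybe V} {T R} → Represents g T R →
    Represents (g ∘ suc) (λ i j → T (suc i) (suc j)) R
  restrict r = record { inj = λ e f → suc-injective (inj e f) ; to = to ; from = from }
    where open Represents r

  elim-step : ∀ {k} {T : Fin (suc k) → Fin (suc k) → Bool} {R} (g : Fin (suc k) → Maybe V) →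
    Simplicial T → Represents g T R → Elim R (collect (g ∘ suc)) → Elim R (collect g)
  elim-step {k} {T} {R} g S r E with g zero in eq
  ... | nothing = E
  ... | just v = step v∉ clique′ width′ E
    where
    open Represents r
    open Simplicial S
    same : ∀ {i j x y} → g (suc i) ≡ just x → g (suc j) ≡ just y → i ≡ j → x ≡ y
    same e f refl = just-injective (trans (sym e) f)
    v∉ : v ∉ collect (g ∘ suc)
    v∉ v∈ with ∈-collect⁻ (g ∘ suc) v∈
    ... | i , e with inj eq e
    ... | ()
    clique′ : ∀ {x y} → x ∈ collect (g ∘ suc) → y ∈ collect (g ∘ suc) → x ≢ y → R v x → R v y → R x y
    clique′ x∈ y∈ x≢y vx vy with ∈-collect⁻ (g ∘ suc) x∈ | ∈-collect⁻ (g ∘ suc) y∈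
    ... | i , e | j , f = from e f (clique i j (x≢y ∘ same e f) (to eq e vx) (to eq f vy))
    width′ : ∀ {x y z} → x ∈ collect (g ∘ suc) → y ∈ collect (g ∘ suc) → z ∈ collect (g ∘ suc) →
      R v x → R v y → R v z → x ≡ y ⊎ x ≡ z ⊎ y ≡ z
    width′ x∈ y∈ z∈ vx vy vz with ∈-collect⁻ (g ∘ suc) x∈ | ∈-collect⁻ (g ∘ suc) y∈ | ∈-collect⁻ (g ∘ suc) z∈
    ... | i , e | j , f | l , h with width i j l (to eq e vx) (to eq f vy) (to eq h vz)
    ... | inj₁ s = inj₁ (same e f s)
    ... | inj₂ (inj₁ s) = inj₂ (inj₁ (same e h s))
    ... | inj₂ (inj₂ s) = inj₂ (inj₂ (same f h s))

  pigeonhole₂ : ∀ {k} → k ≤ 2 → (i j l : Fin k) → i ≡ j ⊎ i ≡ l ⊎ j ≡ l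
  pigeonhole₂ _ zero zero _ = inj₁ refl
  pigeonhole₂ _ zero (suc _) zero = inj₂ (inj₁ refl)
  pigeonhole₂ _ (suc _) zero zero = inj₂ (inj₂ refl)
  pigeonhole₂ (s≤s (s≤s z≤n)) zero (suc zero) (suc zero) = inj₂ (inj₂ refl)
  pigeonhole₂ (s≤s (s≤s z≤n)) (suc zero) (suc zero) _ = inj₁ refl
  pigeonhole₂ (s≤s (s≤s z≤n)) (suc zero) zero (suc zero) = inj₂ (inj₁ refl)

  -- Peeling a vertex off `K3` leaves smaller complete graphs, hence the general `k`. The bound 3
  -- leaves at most two later vertices, and the width condition is the pigeonhole principle.
  elim-complete : ∀ {k T R} (g : Fin k → Maybe V) → k ≤ 3 → (∀ i j → i ≢ j → T i j ≡ true) → Represents g T R →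
    Elim R (collect g)
  elim-complete {zero} g _ _ _ = []
  elim-complete {suc k} g (s≤s k≤2) complete r = elim-step g
    (record { clique = λ i j i≢j _ _ → complete _ _ (i≢j ∘ λ { refl → refl })
            ; width = λ i j l _ _ _ → pigeonhole₂ k≤2 i j l }) r
    (elim-complete (g ∘ suc) (≤-trans k≤2 (n≤1+n 2)) (λ i j i≢j → complete _ _ (i≢j ∘ λ { refl → refl })) (restrict r))

  K3-complete : ∀ i j → i ≢ j → K3 i j ≡ true
  K3-complete i j i≢j with i ≟ j
  ... | yes e = contradiction e i≢j
  ... | no _ = refl

  end : ∀ {k} {a b : Fin k} i → ⌊ i ≟ a ⌋ ∨ ⌊ i ≟ b ⌋ ≡ true → i ≡ a ⊎ i ≡ b
  end {a = a} {b} i e with i ≟ a | i ≟ b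
  ... | yes f | _ = inj₁ f
  ... | no _ | yes f = inj₂ f

  twoTree-sym : ∀ {k T} → IsTwoTree k T → ∀ i j → T i j ≡ T j i
  twoTree-sym base i j with i ≟ j | j ≟ i
  ... | yes _ | yes _ = refl
  ... | no _ | no _ = refl
  ... | yes refl | no f = contradiction refl f
  ... | no f | yes refl = contradiction refl f
  twoTree-sym (step t a b _) zero zero = refl
  twoTree-sym (step t a b _) zero (suc j) = refl
  twoTree-sym (step t a b _) (suc i) zero = refl
  twoTree-sym (step t a b _) (suc i) (suc j) = twoTree-sym t i j

  extend-simplicial : ∀ {k T} → IsTwoTree k T → ∀ a b → T a b ≡ true → Simplicial (extend T a b)
  extend-simplicial {k} {T} t a b ab = record { clique = clique ; width = width }
    where
    clique : ∀ i j → i ≢ j → ⌊ i ≟ a ⌋ ∨ ⌊ i ≟ b ⌋ ≡ true → ⌊ j ≟ a ⌋ ∨ ⌊ j ≟ b ⌋ ≡ true → T i j ≡ true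
    clique i j i≢j e f with end i e | end j f
    ... | inj₁ refl | inj₁ refl = contradiction refl i≢j
    ... | inj₁ refl | inj₂ refl = ab
    ... | inj₂ refl | inj₁ refl = trans (twoTree-sym t b a) ab
    ... | inj₂ refl | inj₂ refl = contradiction refl i≢j
    width : ∀ i j l → ⌊ i ≟ a ⌋ ∨ ⌊ i ≟ b ⌋ ≡ true → ⌊ j ≟ a ⌋ ∨ ⌊ j ≟ b ⌋ ≡ true → ⌊ l ≟ a ⌋ ∨ ⌊ l ≟ b ⌋ ≡ true →
      i ≡ j ⊎ i ≡ l ⊎ j ≡ l
    width i j l e f g with end i e | end j f | end l g
    ... | inj₁ refl | inj₁ refl | _ = inj₁ refl
    ... | inj₂ refl | inj₂ refl | _ = inj₁ refl
    ... | inj₁ refl | inj₂ refl | inj₁ refl = inj₂ (inj₁ refl)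
    ... | inj₁ refl | inj₂ refl | inj₂ refl = inj₂ (inj₂ refl)
    ... | inj₂ refl | inj₁ refl | inj₁ refl = inj₂ (inj₂ refl)
    ... | inj₂ refl | inj₁ refl | inj₂ refl = inj₂ (inj₁ refl)

  elim-twoTree : ∀ {k T R} → IsTwoTree k T → (g : Fin k → Maybe V) → Represents g T R → Elim R (collect g)
  elim-twoTree base g r = elim-complete g (s≤s (s≤s (s≤s z≤n))) K3-complete r
  elim-twoTree (step t a b ab) g r =
    elim-step g (extend-simplicial t a b ab) r (elim-twoTree t (g ∘ suc) (restrict r))

-- Counting short cycles along an elimination order

T⇒≡ : ∀ {x} → T x → x ≡ true
T⇒≡ {true} _ = refl

≡⇒T : ∀ {x} → x ≡ true → T x
≡⇒T refl = _

-- Removing one vertex loses `j` cycles and `suc j` edges, so both sides of the invariant drop by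
-- `suc j`.
tally : ∀ j {l l′ m e e′} → l′ ≡ j + l → e ≡ suc j + e′ → l + m ≡ e′ + 1 → l′ + suc m ≡ e + 1
tally j {l} {m = m} {e′ = e′} refl refl f =
  trans (regroup j l m) (trans (cong (λ k → suc (j + k)) f) (cong suc (sym (+-assoc j e′ 1))))
  where
  regroup : ∀ j l m → j + l + suc m ≡ suc (j + (l + m))
  regroup = solve-∀

module _ {n : ℕ} where

  neighbours : Graph n → Fin n → List (Fin n) → List (Fin n)
  neighbours G v = filterᵇ (adj G v)

  Counted : Graph n → List (Fin n) → (Fin n → Fin n → List (Fin n)) → Set
  Counted G vs lsp = ∃ λ L → Enumerates G lsp L × length L + length vs ≡ edges G vs + 1

  counted-single : ∀ {G v lsp} → PathSystem G [ v ] lsp → Counted G [ v ] lsp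
  counted-single {G} {v} {lsp} S = [] , ([] , [] , λ C sh → contradiction (proj₁ sh) none) , refl
    where
    open PathSystemProperties S
    none : ∀ {C} → ¬ IsCycle G C
    none {C@(_ ∷ _)} cyc@(_ , _ , l) with ∈-cyc C (here refl)
    ... | j , e with cycle-∈ {C = C} cyc (here refl) | cycle-∈ {C = C} cyc (cyc-∈ C (cyc-sym C e))
    ... | here refl | here refl = adj-irrefl G (cyc-linked (adj-swap G) C l e)
    none {[]} (() , _)

  -- The induction hypothesis is offered to every graph whose new edges join two neighbours of `v`.
  -- This keeps the graph inside the relation `R` of the elimination order, in which the later
  -- neighbours of `v` form a clique.
  module _ {G : Graph n} {v u us lsp} (S : PathSystem G (v ∷ u ∷ us) lsp) (v∉ : v ∉ u ∷ us) (uniq : Unique (u ∷ us))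
           (IH : ∀ {H lsp′} → PathSystem H (u ∷ us) lsp′ →
                 (∀ {x y} → Adj H x y → Adj G x y ⊎ (x ≢ y × Adj G v x × Adj G v y)) → Counted H (u ∷ us) lsp′) where

    open PathSystemProperties S

    private
      vs ws : List (Fin n)
      vs = u ∷ us
      ws = v ∷ vs

      ≢v : ∀ {x} → x ∈ vs → x ≢ v
      ≢v x∈ refl = v∉ x∈

    -- Connectivity is contained in `isPath`: the chosen path from `v` to the remaining vertex `u`
    -- starts with an edge at `v`, so this case is void.
    counted-isolated : (∀ {x} → ¬ Adj G v x) → Counted G ws lsp
    counted-isolated none with lsp-head {v} {u} (here refl) (there (here refl)) | isPath S {v} {u} (here refl) (there (here refl))
    ... | [] , e | _ , l , _ rewrite e = contradiction (sym (just-injective l)) (≢v (here refl))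
    ... | z ∷ q , e | _ , _ , _ , k rewrite e = contradiction (linked⇒ k (here refl)) none

    module _ (avoid : ∀ {x y} → x ∈ vs → y ∈ vs → v ∉ lsp x y) where
      open Deletion S v∉ avoid hiding (≢v)

      counted-deletion : Counted G′ vs lsp
      counted-deletion = IH system (λ e → inj₁ ([ id , ⊥-elim ]′ (proj₂ (proj₂ (adj⇒ e)))))

      edges-deletion : edges G′ vs ≡ edges G vs
      edges-deletion = edges-cong G′ G vs λ x∈ y∈ →
        ≡-fromIff (λ e → [ id , ⊥-elim ]′ (proj₂ (proj₂ (adj⇒ e)))) (λ e → ⇒adj (≢v x∈ , ≢v y∈ , inj₁ e))

    counted-pendant : ∀ {a} → (∀ {x} → Adj G v x → x ≡ a) → edges G ws ≡ 1 + edges G vs → Counted G ws lsp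
    counted-pendant only deg = let L , enum , size = counted-deletion avoid in
      L , enumerates-pendant none enum ,
      tally 0 refl (trans deg (cong suc (sym (edges-deletion avoid)))) size
      where
      avoid : ∀ {x y} → x ∈ vs → y ∈ vs → v ∉ lsp x y
      avoid x∈ y∈ v∈ with through (there x∈) (there y∈) (≢v x∈) (≢v y∈) v∈
      ... | s , t , sv , vt , s≢t , _ = s≢t (trans
        (only (adj-swap G (lsp-adj (there x∈) (there y∈) sv))) (sym (only (lsp-adj (there x∈) (there y∈) vt))))
      open Deletion S v∉ avoid using (enumerates-pendant)
      none : ∀ {C} → IsCycle G C → v ∉ C
      none cyc v∈ with cycle-ends G cyc v∈
      ... | _ , _ , _ , _ , _ , _ , _ , vs , vt , s≢t = s≢t (trans (only vs) (sym (only vt)))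

    module _ {a b} (D : Degree2 G v a b) (deg : edges G ws ≡ 2 + edges G vs) where
      open Degree2 D

      private
        a∈ : a ∈ ws
        a∈ = adj-∈ʳ va
        b∈ : b ∈ ws
        b∈ = adj-∈ʳ vb

      counted-cone : v ∉ lsp a b → Counted G ws lsp
      counted-cone v∉lsp = let L , enum , size = counted-deletion avoid in
        (v ∷ lsp a b) ∷ L , enumerates-cone D enum ,
        tally 1 refl (trans deg (cong (2 +_) (sym (edges-deletion avoid)))) size
        where
        avoid : ∀ {x y} → x ∈ vs → y ∈ vs → v ∉ lsp x y
        avoid x∈ y∈ v∈ with through (there x∈) (there y∈) (≢v x∈) (≢v y∈) v∈
        ... | s , t , sv , vt , s≢t , e
          with pair (adj-swap G (lsp-adj (there x∈) (there y∈) sv)) (lsp-adj (there x∈) (there y∈) vt) s≢t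
        ... | inj₁ (refl , refl) = v∉lsp (subst (v ∈_) (sym e) (there (here refl)))
        ... | inj₂ (refl , refl) =
          v∉lsp (subst (v ∈_) (sym (trans (rev S b∈ a∈) (cong reverse e))) (there (here refl)))
        open Deletion S v∉ avoid using (enumerates-cone)

      -- The vertices beside `v` on `lsp a b` can only be `a` and `b`, and the stretch between them
      -- is chosen by `through`; hence the path is exactly `a v b`.
      counted-contraction : v ∈ lsp a b → Counted G ws lsp
      counted-contraction v∈ with through a∈ b∈ (λ { refl → adj-irrefl G va }) (λ { refl → adj-irrefl G vb }) v∈
      ... | s , t , sv , vt , s≢t , e = let L , enum , size = counted′ in go (adj G a b Bool.≟ true) L enum size
        where
        mid : lsp a b ≡ a ∷ v ∷ b ∷ []
        mid with pair (adj-swap G (lsp-adj a∈ b∈ sv)) (lsp-adj a∈ b∈ vt) s≢t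
        ... | inj₁ (refl , refl) = e
        ... | inj₂ (refl , refl) = trans (rev S b∈ a∈) (cong reverse e)
        module C = Contraction S v∉ D mid
        open C using (G′; lsp′; adj⇒; ⇒adj; a≢v; b≢v; enumerates-subdivide; enumerates-triangle)
        counted′ : Counted G′ vs lsp′
        counted′ = IH C.system new
          where
          new : ∀ {x y} → Adj G′ x y → Adj G x y ⊎ (x ≢ y × Adj G v x × Adj G v y)
          new e with proj₂ (proj₂ (adj⇒ e))
          ... | inj₁ f = inj₁ f
          ... | inj₂ (inj₁ (refl , refl)) = inj₂ (a≢b , va , vb)
          ... | inj₂ (inj₂ (refl , refl)) = inj₂ (≢-sym a≢b , vb , va)
        agree : ∀ {x y} → x ∈ vs → y ∈ vs → (Link a b x y → Adj G x y) → adj G′ x y ≡ adj G x y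
        agree x∈ y∈ f = ≡-fromIff (λ e → [ id , f ]′ (proj₂ (proj₂ (adj⇒ e)))) (λ e → ⇒adj (≢v x∈ , ≢v y∈ , inj₁ e))
        go : Dec (Adj G a b) → ∀ L → Enumerates G′ lsp′ L → length L + length vs ≡ edges G′ vs + 1 → Counted G ws lsp
        -- If `ab` was present, both edges at `v` are lost; if not, the new edge `ab` makes up for
        -- one of them.
        go (yes ab) L enum size = let M , len , enum′ = enumerates-triangle ab enum in
          M , enum′ , tally 1 (sym len) (trans deg (cong (2 +_) (sym
            (edges-cong G′ G vs (λ x∈ y∈ → agree x∈ y∈ (link-resp (Adj G) (adj-swap G) ab)))))) size
        go (no ¬ab) L enum size = let M , len , enum′ = enumerates-subdivide ¬ab enum in
          M , enum′ , tally 0 (sym len) (trans deg (cong suc (sym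
            (edges-add G G′ vs uniq (C.a∈) (C.b∈) a≢b ¬ab (⇒adj (a≢v , b≢v , inj₂ (inj₁ (refl , refl))))
              (λ x∈ y∈ ¬k → agree x∈ y∈ (λ k → contradiction k ¬k)))))) size

  counted : ∀ {R : Fin n → Fin n → Set} {v vs} → Elim R (v ∷ vs) → ∀ {G lsp} → PathSystem G (v ∷ vs) lsp →
    (∀ {x y} → Adj G x y → R x y) → Counted G (v ∷ vs) lsp
  counted {vs = []} _ S _ = counted-single S
  counted {R} {v} {vs@(u ∷ us)} (step v∉ clique width E) {G} {lsp} S G⊆R = by-degree (neighbours G v vs) refl
    where
    open PathSystemProperties S
    uniq = elim-unique E
    nb∈ : ∀ {x} → Adj G v x → x ∈ vs
    nb∈ e with adj-∈ʳ e
    ... | here refl = contradiction e (adj-irrefl G)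
    ... | there x∈ = x∈
    IH : ∀ {H lsp′} → PathSystem H vs lsp′ →
      (∀ {x y} → Adj H x y → Adj G x y ⊎ (x ≢ y × Adj G v x × Adj G v y)) → Counted H vs lsp′
    IH S′ new = counted E S′ λ e →
      [ G⊆R , (λ (x≢y , vx , vy) → clique (nb∈ vx) (nb∈ vy) x≢y (G⊆R vx) (G⊆R vy)) ]′ (new e)
    nb⁺ : ∀ {x} → Adj G v x → x ∈ neighbours G v vs
    nb⁺ e = ∈-filter⁺ (T? ∘ adj G v) (nb∈ e) (≡⇒T e)
    nb⁻ : ∀ {x} → x ∈ neighbours G v vs → Adj G v x
    nb⁻ x∈ = T⇒≡ (proj₂ (∈-filter⁻ (T? ∘ adj G v) {xs = vs} x∈))
    nb-unique : Unique (neighbours G v vs)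
    nb-unique = filter⁺ (T? ∘ adj G v) uniq
    degree : ∀ {k} → length (neighbours G v vs) ≡ k → edges G (v ∷ vs) ≡ k + edges G vs
    degree e = cong (_+ edges G vs) (trans (sym (length-filterᵇ (adj G v) vs)) e)
    by-degree : ∀ ns → neighbours G v vs ≡ ns → Counted G (v ∷ vs) lsp
    by-degree [] e = counted-isolated S v∉ uniq IH λ f → contradiction (subst (_ ∈_) e (nb⁺ f)) λ ()
    by-degree (a ∷ []) e = counted-pendant S v∉ uniq IH {a} (λ f → only (subst (_ ∈_) e (nb⁺ f))) (degree (cong length e))
      where
      only : ∀ {x} → x ∈ [ a ] → x ≡ a
      only (here f) = f
    by-degree (a ∷ b ∷ []) e = [ counted-contraction S v∉ uniq IH D two , counted-cone S v∉ uniq IH D two ]′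
      (toSum (v ∈? lsp a b))
      where
      open DecMem (_≟_ {n}) using (_∈?_)
      two : edges G (v ∷ vs) ≡ 2 + edges G vs
      two = degree (cong length e)
      either : ∀ {x} → x ∈ a ∷ b ∷ [] → x ≡ a ⊎ x ≡ b
      either (here f) = inj₁ f
      either (there (here f)) = inj₂ f
      D : Degree2 G v a b
      D = record
        { a≢b  = λ { refl → Unique[x∷xs]⇒x∉xs (subst Unique e nb-unique) (here refl) }
        ; va   = nb⁻ (subst (a ∈_) (sym e) (here refl))
        ; vb   = nb⁻ (subst (b ∈_) (sym e) (there (here refl)))
        ; nbrs = λ f → either (subst (_ ∈_) e (nb⁺ f)) }
    by-degree (a ∷ b ∷ c ∷ cs) e = contradiction
      (width (nb∈ va) (nb∈ vb) (nb∈ vc) (G⊆R va) (G⊆R vb) (G⊆R vc)) three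
      where
      va = nb⁻ (subst (a ∈_) (sym e) (here refl))
      vb = nb⁻ (subst (b ∈_) (sym e) (there (here refl)))
      vc = nb⁻ (subst (c ∈_) (sym e) (there (there (here refl))))
      u′ : Unique (a ∷ b ∷ c ∷ cs)
      u′ = subst Unique e nb-unique
      three : ¬ (a ≡ b ⊎ a ≡ c ⊎ b ≡ c)
      three (inj₁ refl) = Unique[x∷xs]⇒x∉xs u′ (here refl)
      three (inj₂ (inj₁ refl)) = Unique[x∷xs]⇒x∉xs u′ (there (here refl))
      three (inj₂ (inj₂ refl)) = Unique[x∷xs]⇒x∉xs (unique-tail u′) (here refl)

-- Lex shortest paths

unique-⊆-length : ∀ {A : Set} (xs : List A) {ys} → Unique xs → (∀ {x} → x ∈ xs → x ∈ ys) → length xs ≤ length ys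
unique-⊆-length [] u f = z≤n
unique-⊆-length (x ∷ xs) {ys} u f with ∈-∃++ (f (here refl))
... | as , bs , refl = subst (suc (length xs) ≤_) (sym split)
        (s≤s (unique-⊆-length xs (unique-tail u) λ y∈ → others y∈ (∈-++⁻ as (f (there y∈)))))
  where
  split : length (as ++ x ∷ bs) ≡ suc (length (as ++ bs))
  split = trans (length-++ as) (trans (+-suc (length as) (length bs)) (cong suc (sym (length-++ as))))
  others : ∀ {y} → y ∈ xs → y ∈ as ⊎ y ∈ x ∷ bs → y ∈ as ++ bs
  others y∈ (inj₁ y∈as) = ∈-++⁺ˡ y∈as
  others y∈ (inj₂ (here refl)) = contradiction y∈ (Unique[x∷xs]⇒x∉xs u)
  others y∈ (inj₂ (there y∈bs)) = ∈-++⁺ʳ as y∈bs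

unique-length : ∀ {n} {p : List (Fin n)} → Unique p → length p < suc n
unique-length {n} {p} u = s≤s (subst (length p ≤_) (length-tabulate id) (unique-⊆-length p u (λ {x} _ → ∈-allFin x)))

minimal : ∀ {A : Set} {R : A → A → Set} → (∀ x y → Dec (R x y)) → (∀ {x} → ¬ R x x) → (∀ {x y z} → R x y → R y z → R x z) →
  ∀ x xs → ∃ λ m → m ∈ x ∷ xs × (∀ {y} → y ∈ x ∷ xs → ¬ R y m)
minimal R? irr tr x [] = x , here refl , λ { (here refl) → irr }
minimal R? irr tr x (y ∷ xs) with minimal R? irr tr y xs
... | m , m∈ , min with R? x m
... | yes xm = x , here refl , λ { (here refl) → irr ; (there z∈) zx → min z∈ (tr zx xm) }
... | no ¬xm = m , there m∈ , λ { (here refl) → ¬xm ; (there z∈) → min z∈ }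

-- A finite search space: a path has at most `n` vertices, so all paths occur in `lists n` and a
-- best one is found by filtering.
lists : ∀ {n} → ℕ → List (List (Fin n))
lists zero = [] ∷ []
lists {n} (suc k) = [] ∷ cartesianProductWith _∷_ (allFin n) (lists k)

∈-lists : ∀ {n} (p : List (Fin n)) {k} → length p ≤ k → p ∈ lists k
∈-lists [] {zero} _ = here refl
∈-lists [] {suc k} _ = here refl
∈-lists (x ∷ p) (s≤s le) = there (∈-cartesianProductWith⁺ _∷_ (∈-allFin x) (∈-lists p le))

module _ {n : ℕ} (G : Graph n) where

  isPath? : ∀ u v p → Dec (IsPath G u v p)
  isPath? u v p = Maybe.≡-dec _≟_ (head p) (just u) ×-dec Maybe.≡-dec _≟_ (last p) (just v) ×-dec
    unique? _≟_ p ×-dec linked? (λ i j → adj G i j Bool.≟ true) p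

  path-suffix : ∀ r {x y z s} → IsPath G x y (r ++ z ∷ s) → IsPath G z y (z ∷ s)
  path-suffix r {z = z} {s} (_ , l , u , k) = refl , trans (sym (last-++ r z s)) l , unique-infix r u ,
    ⇒linked (z ∷ s) (linked⇒ k ∘ consec-++⁺ʳ r)

  path-cons : ∀ {x y z p} → Adj G x z → x ∉ p → IsPath G z y p → IsPath G x y (x ∷ p)
  path-cons {p = z ∷ p} e x∉ (refl , l , u , k) = refl , l , ¬Any⇒All¬ _ x∉ ∷ u , e ∷ k

  path-reverse : ∀ {x y p} → IsPath G x y p → IsPath G y x (reverse p)
  path-reverse {p = p} (h , l , u , k) = trans (head-reverse p) l , trans (last-reverse p) h , unique-reverse u ,
    ⇒linked (reverse p) λ {s} {t} e → adj-swap G (linked⇒ k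
      (subst (λ q → (t , s) ∈ consec q) (reverse-involutive p) (consec-reverse (reverse p) e)))

module Shortest {n} (G : Graph n) (w : Fin n → Fin n → ℕ) (_≺_ : Rel (Fin n) 0ℓ) (connected : Connected G)
                (w-sym : ∀ i j → w i j ≡ w j i) (sto : IsStrictTotalOrder _≡_ _≺_) where

  open IsStrictTotalOrder sto using (compare) renaming (trans to ≺-trans; irrefl to ≺-irrefl; _<?_ to _≺?_)
  open DecMem (_≟_ {n}) using (_∈?_)

  private
    Path : Set
    Path = List (Fin n)
    variable
      x y z : Fin n
      p q r P Q R : Path

  -- A path has at most n vertices, so this orders paths by weight and then by length.
  cost : Path → ℕ
  cost p = pathWeight w p * suc n + length p

  cost-weight-< : ∀ p q → Unique p → pathWeight w p < pathWeight w q → cost p < cost q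
  cost-weight-< p q u lt = begin-strict
    pathWeight w p * suc n + length p <⟨ +-monoʳ-< _ (unique-length u) ⟩
    pathWeight w p * suc n + suc n    ≡⟨ +-comm _ (suc n) ⟩
    suc (pathWeight w p) * suc n      ≤⟨ *-monoˡ-≤ (suc n) lt ⟩
    pathWeight w q * suc n            ≤⟨ m≤m+n _ _ ⟩
    cost q                            ∎
    where open ≤-Reasoning

  cost-length-< : ∀ p q → pathWeight w p ≡ pathWeight w q → length p < length q → cost p < cost q
  cost-length-< p q e lt = subst (λ k → cost p < k * suc n + length q) e (+-monoʳ-< (pathWeight w p * suc n) lt)

  cost-≤ : ∀ p q → Unique q → cost p ≤ cost q →
    pathWeight w p < pathWeight w q ⊎ (pathWeight w p ≡ pathWeight w q × length p ≤ length q)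
  cost-≤ p q u le with <-cmp (pathWeight w p) (pathWeight w q)
  ... | tri< lt _ _ = inj₁ lt
  ... | tri> _ _ gt = contradiction le (<⇒≱ (cost-weight-< q p u gt))
  ... | tri≈ _ e _ = inj₂ (e , +-cancelˡ-≤ (pathWeight w p * suc n) _ _
          (subst (λ k → cost p ≤ k * suc n + length q) (sym e) le))

  cost-∷ : ∀ x z p → cost (x ∷ z ∷ p) ≡ suc (w x z * suc n) + cost (z ∷ p)
  cost-∷ x z p = regroup (w x z) (pathWeight w (z ∷ p)) (suc n) (length (z ∷ p))
    where
    regroup : ∀ a b c d → (a + b) * c + suc d ≡ suc (a * c) + (b * c + d)
    regroup = solve-∀

  cost-head : ∀ r → head r ≡ just z → cost (x ∷ r) ≡ suc (w x z * suc n) + cost r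
  cost-head {x = x} (z ∷ r) refl = cost-∷ x z r

  -- The length term makes this strict even for an edge of weight 0.
  cost-tail : ∀ x z p → cost (z ∷ p) < cost (x ∷ z ∷ p)
  cost-tail x z p = subst (cost (z ∷ p) <_) (sym (cost-∷ x z p)) (s≤s (m≤n+m (cost (z ∷ p)) (w x z * suc n)))

  cost-suffix : ∀ r z s → cost (z ∷ s) ≤ cost (r ++ z ∷ s)
  cost-suffix [] z s = ≤-refl
  cost-suffix (x ∷ []) z s = <⇒≤ (cost-tail x z s)
  cost-suffix (x ∷ y ∷ r) z s = ≤-trans (cost-suffix (y ∷ r) z s) (<⇒≤ (cost-tail x y (r ++ z ∷ s)))

  cost-suffix-< : ∀ x r z s → cost (z ∷ s) < cost (x ∷ r ++ z ∷ s)
  cost-suffix-< x [] z s = cost-tail x z s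
  cost-suffix-< x (y ∷ r) z s = ≤-<-trans (cost-suffix (y ∷ r) z s) (cost-tail x y (r ++ z ∷ s))

  weight-++ : ∀ xs z ys → pathWeight w (xs ++ z ∷ ys) ≡ pathWeight w (xs ++ [ z ]) + pathWeight w (z ∷ ys)
  weight-++ [] z ys = refl
  weight-++ (x ∷ []) z ys = cong (_+ pathWeight w (z ∷ ys)) (sym (+-identityʳ (w x z)))
  weight-++ (x ∷ y ∷ xs) z ys = trans (cong (w x y +_) (weight-++ (y ∷ xs) z ys)) (sym (+-assoc (w x y) _ _))

  weight-reverse : ∀ p → pathWeight w (reverse p) ≡ pathWeight w p
  weight-reverse [] = refl
  weight-reverse (x ∷ []) = refl
  weight-reverse (x ∷ y ∷ p) = trans (cong (pathWeight w) unfold)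
    (trans (weight-++ (reverse p) y [ x ]) (trans (cong₂ _+_
      (trans (cong (pathWeight w) (sym (unfold-reverse y p))) (weight-reverse (y ∷ p)))
      (trans (+-identityʳ (w y x)) (w-sym y x))) (+-comm _ (w x y))))
    where
    unfold : reverse (x ∷ y ∷ p) ≡ reverse p ++ y ∷ x ∷ []
    unfold = trans (unfold-reverse x (y ∷ p))
      (trans (cong (_++ [ x ]) (unfold-reverse y p)) (++-assoc (reverse p) [ y ] [ x ]))

  cost-reverse : ∀ p → cost (reverse p) ≡ cost p
  cost-reverse p = cong₂ (λ a b → a * suc n + b) (weight-reverse p) (length-reverse p)

  -- P contains the ≺-least vertex of the symmetric difference.
  _⊲_ : Path → Path → Set
  P ⊲ Q = ∃ λ b → b ∈ P × b ∉ Q × (∀ y → y ≺ b → (y ∈ P → y ∈ Q) × (y ∈ Q → y ∈ P))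

  ⊲? : ∀ P Q → Dec (P ⊲ Q)
  ⊲? P Q = any? λ b → b ∈? P ×-dec ¬? (b ∈? Q) ×-dec
    all? λ y → y ≺? b →-dec ((y ∈? P →-dec y ∈? Q) ×-dec (y ∈? Q →-dec y ∈? P))

  ⊲-trans : P ⊲ Q → Q ⊲ R → P ⊲ R
  ⊲-trans (b , b∈P , b∉Q , f) (c , c∈Q , c∉R , g) with compare b c
  ... | tri< b≺c _ _ = b , b∈P , b∉Q ∘ proj₂ (g b b≺c) , λ y y≺b →
          proj₁ (g y (≺-trans y≺b b≺c)) ∘ proj₁ (f y y≺b) , proj₂ (f y y≺b) ∘ proj₂ (g y (≺-trans y≺b b≺c))
  ... | tri≈ _ refl _ = contradiction c∈Q b∉Q
  ... | tri> _ _ c≺b = c , proj₂ (f c c≺b) c∈Q , c∉R , λ y y≺c →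
          proj₁ (g y y≺c) ∘ proj₁ (f y (≺-trans y≺c c≺b)) , proj₂ (f y (≺-trans y≺c c≺b)) ∘ proj₂ (g y y≺c)

  least : ∀ {S : Fin n → Set} → (∀ x → Dec (S x)) → ∃ S → ∃ (IsMin _≺_ S)
  least {S} S? (s , Ss) = [ (λ (m , Sm , f) → m , Sm , λ y → f (∈-allFin y)) , (λ f → ⊥-elim (f (∈-allFin s) Ss)) ]′ (go (allFin n))
    where
    go : ∀ xs → (∃ λ m → S m × (∀ {y} → y ∈ xs → S y → m ≡ y ⊎ m ≺ y)) ⊎ (∀ {y} → y ∈ xs → ¬ S y)
    go [] = inj₂ λ ()
    go (x ∷ xs) with go xs | S? x
    ... | inj₂ f | no ¬s = inj₂ λ { (here refl) → ¬s ; (there y∈) → f y∈ }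
    ... | inj₂ f | yes s = inj₁ (x , s , λ { (here refl) _ → inj₁ refl ; (there y∈) t → contradiction t (f y∈) })
    ... | inj₁ (m , t , f) | no ¬s = inj₁ (m , t , λ { (here refl) s → contradiction s ¬s ; (there y∈) → f y∈ })
    ... | inj₁ (m , t , f) | yes s with compare x m
    ... | tri< x≺m _ _ = inj₁ (x , s , λ { (here refl) _ → inj₁ refl
            ; (there y∈) r → inj₂ ([ (λ { refl → x≺m }) , ≺-trans x≺m ]′ (f y∈ r)) })
    ... | tri≈ _ refl _ = inj₁ (m , t , λ { (here refl) _ → inj₁ refl ; (there y∈) → f y∈ })
    ... | tri> _ _ m≺x = inj₁ (m , t , λ { (here refl) _ → inj₂ m≺x ; (there y∈) → f y∈ })

  Differ : Path → Path → Fin n → Set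
  Differ P Q y = Diff P Q y ⊎ Diff Q P y

  diff? : ∀ P Q y → Dec (Diff P Q y)
  diff? P Q y = y ∈? P ×-dec ¬? (y ∈? Q)

  differ? : ∀ P Q y → Dec (Differ P Q y)
  differ? P Q y = diff? P Q y ⊎-dec diff? Q P y

  not-diff : ∀ P Q {y} → ¬ Diff P Q y → y ∈ P → y ∈ Q
  not-diff P Q {y} ¬d y∈ = decidable-stable (y ∈? Q) (λ y∉ → ¬d (y∈ , y∉))

  agree : ∀ P Q y → ¬ Differ P Q y → (y ∈ P → y ∈ Q) × (y ∈ Q → y ∈ P)
  agree P Q y ¬d = not-diff P Q (¬d ∘ inj₁) , not-diff Q P (¬d ∘ inj₂)

  below-least : ∀ {S b y} → IsMin _≺_ S b → y ≺ b → ¬ S y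
  below-least (_ , f) y≺b s = [ (λ { refl → ≺-irrefl refl y≺b }) , (λ b≺y → ≺-irrefl refl (≺-trans b≺y y≺b)) ]′ (f _ s)

  ⊲-cmp : ∀ P Q → P ⊲ Q ⊎ Q ⊲ P ⊎ (∀ y → (y ∈ P → y ∈ Q) × (y ∈ Q → y ∈ P))
  ⊲-cmp P Q with any? (differ? P Q)
  ... | no none = inj₂ (inj₂ λ y → agree P Q y (λ d → none (y , d)))
  ... | yes some with least (differ? P Q) some
  ... | b , m@(inj₁ (p , ¬q) , _) = inj₁ (b , p , ¬q , λ y y≺b → agree P Q y (below-least m y≺b))
  ... | b , m@(inj₂ (q , ¬p) , _) = inj₂ (inj₁ (b , q , ¬p , λ y y≺b → agree Q P y (below-least m y≺b ∘ swap)))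

  _⊏_ : Path → Path → Set
  P ⊏ Q = cost P < cost Q ⊎ (cost P ≡ cost Q × P ⊲ Q)

  ⊏? : ∀ P Q → Dec (P ⊏ Q)
  ⊏? P Q = (cost P <? cost Q) ⊎-dec (cost P Nat.≟ cost Q ×-dec ⊲? P Q)

  ⊏-irrefl : ¬ P ⊏ P
  ⊏-irrefl (inj₁ lt) = <-irrefl refl lt
  ⊏-irrefl (inj₂ (_ , b , b∈ , b∉ , _)) = b∉ b∈

  ⊏-trans : P ⊏ Q → Q ⊏ R → P ⊏ R
  ⊏-trans (inj₁ a) (inj₁ b) = inj₁ (<-trans a b)
  ⊏-trans (inj₁ a) (inj₂ (e , _)) = inj₁ (<-≤-trans a (≤-reflexive e))
  ⊏-trans (inj₂ (e , _)) (inj₁ b) = inj₁ (≤-<-trans (≤-reflexive e) b)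
  ⊏-trans {P} {Q} {R} (inj₂ (e , a)) (inj₂ (f , b)) = inj₂ (trans e f , ⊲-trans {P} {Q} {R} a b)

  -- `⊲` sees only vertex sets, so two best paths might still visit the same vertices in different
  -- orders. Minimal cost alone excludes this, see `cheapest-unique`, and is therefore isolated as a
  -- property that tails inherit.
  Cheapest : Fin n → Fin n → Path → Set
  Cheapest x y P = IsPath G x y P × (∀ {Q} → IsPath G x y Q → cost P ≤ cost Q)

  Best : Fin n → Fin n → Path → Set
  Best x y P = IsPath G x y P × (∀ {Q} → IsPath G x y Q → ¬ Q ⊏ P)

  best-exists : ∀ x y → ∃ (Best x y)
  best-exists x y with some-path
    where
    some-path : ∃ (IsPath G x y)
    some-path with x ≟ y
    ... | yes refl = [ x ] , refl , refl , [] ∷ [] , [-]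
    ... | no x≢y = connected x y x≢y
  ... | p , path with filter (isPath? G x y) (lists n) in eq
  ... | [] = contradiction (subst (p ∈_) eq (∈-filter⁺ (isPath? G x y)
               (∈-lists p (s≤s⁻¹ (unique-length (proj₁ (proj₂ (proj₂ path)))))) path)) λ ()
  ... | r ∷ rs with minimal ⊏? (λ {P} → ⊏-irrefl {P}) (λ {P} {Q} {R} → ⊏-trans {P} {Q} {R}) r rs
  ... | m , m∈ , min = m , proj₂ (∈-filter⁻ (isPath? G x y) {xs = lists n} (subst (m ∈_) (sym eq) m∈)) ,
        λ {Q} path′ → min (subst (Q ∈_) eq (∈-filter⁺ (isPath? G x y)
          (∈-lists Q (s≤s⁻¹ (unique-length (proj₁ (proj₂ (proj₂ path′)))))) path′))

  best-cheapest : Best x y P → Cheapest x y P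
  best-cheapest (path , f) = path , λ path′ → ≮⇒≥ (λ lt → f path′ (inj₁ lt))

  -- A competitor r for the tail z ∷ p is extended by x, or shortcut at x when it meets x.
  competitor : IsPath G x y (x ∷ z ∷ p) → IsPath G z y r →
    (x ∉ r × IsPath G x y (x ∷ r)) ⊎ (∃ λ s → IsPath G x y s × cost s ≤ cost r)
  competitor {x} {r = r} (_ , _ , _ , e ∷ _) path with x ∈? r
  ... | no x∉ = inj₁ (x∉ , path-cons G e x∉ path)
  ... | yes x∈ with ∈-∃++ x∈
  ... | r₁ , r₂ , refl = inj₂ (x ∷ r₂ , path-suffix G r₁ path , cost-suffix r₁ x r₂)

  cheapest-tail : Cheapest x y (x ∷ z ∷ p) → Cheapest z y (z ∷ p)
  cheapest-tail {x} {y} {z} {p} (path , f) = path-suffix G [ x ] path , λ path′ →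
    [ (λ (x∉ , path″) → +-cancelˡ-≤ (suc (w x z * suc n)) _ _
        (subst₂ _≤_ (cost-∷ x z p) (cost-head _ (proj₁ path′)) (f path″))) ,
      -- The shortcut costs at least as much as the whole path, hence more than its tail.
      (λ (s , path″ , le) → ≤-trans (<⇒≤ (cost-tail x z p)) (≤-trans (f path″) le)) ]′ (competitor path path′)

  -- If the second vertices differ, each path passes the other's second vertex
  -- further on, and both tails would be strictly cheaper than each other.
  cheapest-tails : ∀ x p {q} → Cheapest x y (x ∷ p) → Cheapest x y (x ∷ q) →
    (∀ {i} → i ∈ x ∷ p → i ∈ x ∷ q) → (∀ {i} → i ∈ x ∷ q → i ∈ x ∷ p) → p ≡ q
  cheapest-tails x [] ((_ , refl , _) , _) (path′ , _) _ _ = sym (∷-injectiveʳ (path-trivial {G = G} path′))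
  cheapest-tails x (z ∷ p) {[]} ((_ , l , u , _) , _) ((_ , refl , _) , _) _ _ =
    contradiction (last-∈ (z ∷ p) l) (Unique[x∷xs]⇒x∉xs u)
  cheapest-tails x (z ∷ p) {z′ ∷ q} C@((_ , _ , u , _) , _) C′@((_ , _ , u′ , _) , _) f g with z ≟ z′
  ... | yes refl = cong (z ∷_) (cheapest-tails z p (cheapest-tail C) (cheapest-tail C′)
        (λ i∈ → strip u i∈ (f (there i∈))) (λ i∈ → strip u′ i∈ (g (there i∈))))
    where
    strip : ∀ {i m q} → Unique (x ∷ m) → i ∈ m → i ∈ x ∷ q → i ∈ q
    strip u i∈ (here refl) = contradiction i∈ (Unique[x∷xs]⇒x∉xs u)
    strip u i∈ (there j∈) = j∈
  ... | no z≢z′ = contradiction (<-trans (ahead C C′ (f (there (here refl))) z≢z′ u)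
                     (ahead C′ C (g (there (here refl))) (≢-sym z≢z′) u′)) (<-irrefl refl)
    where
    ahead : ∀ {z z′ p q} → Cheapest x _ (x ∷ z ∷ p) → Cheapest x _ (x ∷ z′ ∷ q) → z ∈ x ∷ z′ ∷ q → z ≢ z′ →
      Unique (x ∷ z ∷ p) → cost (z ∷ p) < cost (z′ ∷ q)
    ahead C C′ (here refl) _ u = contradiction (here refl) (Unique[x∷xs]⇒x∉xs u)
    ahead C C′ (there (here e)) z≢z′ _ = contradiction e z≢z′
    ahead {z} {z′} C C′ (there (there z∈)) _ _ with ∈-∃++ z∈
    ... | r , s , refl = ≤-<-trans (proj₂ (cheapest-tail C) (path-suffix G (x ∷ z′ ∷ r) (proj₁ C′)))
            (cost-suffix-< z′ r z s)

  cheapest-unique : Cheapest x y P → Cheapest x y Q → (∀ {i} → i ∈ P → i ∈ Q) → (∀ {i} → i ∈ Q → i ∈ P) → P ≡ Q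
  cheapest-unique {P = x ∷ p} {_ ∷ _} C@((refl , _) , _) C′@((refl , _) , _) f g = cong (x ∷_) (cheapest-tails x p C C′ f g)

  best-unique : Best x y P → Best x y Q → P ≡ Q
  best-unique {P = P} {Q} B@(path , f) B′@(path′ , g) with <-cmp (cost P) (cost Q)
  ... | tri< lt _ _ = contradiction (inj₁ lt) (g path)
  ... | tri> _ _ gt = contradiction (inj₁ gt) (f path′)
  ... | tri≈ _ e _ with ⊲-cmp P Q
  ... | inj₁ a = contradiction (inj₂ (e , a)) (g path)
  ... | inj₂ (inj₁ a) = contradiction (inj₂ (sym e , a)) (f path′)
  ... | inj₂ (inj₂ same) = cheapest-unique (best-cheapest B) (best-cheapest B′) (proj₁ (same _)) (proj₂ (same _))

  -- Prefixing `x` to a better tail gives a better whole: it adds the same amount to both costs, and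
  -- it leaves `⊲` intact because `x` then lies on both paths. A better tail that already meets `x`
  -- is cut there, which yields a strictly cheaper path from `x`.
  best-tail : Best x y (x ∷ z ∷ p) → Best z y (z ∷ p)
  best-tail {x} {y} {z} {p} (path@(_ , _ , u , _) , f) = path-suffix G [ x ] path , better
    where
    better : ∀ {r} → IsPath G z y r → ¬ r ⊏ (z ∷ p)
    better {r} path′ r⊏ with competitor path path′
    ... | inj₂ (s , path″ , le) = f path″ (inj₁ (≤-<-trans le (≤-<-trans r≤ (cost-tail x z p))))
      where
      r≤ : cost r ≤ cost (z ∷ p)
      r≤ = [ <⇒≤ , (λ (e , _) → ≤-reflexive e) ]′ r⊏
    ... | inj₁ (x∉ , path″) = f path″ ([ inj₁ ∘ cheaper , (λ (e , a) → inj₂ (equal e , extend-⊲ a)) ]′ r⊏)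
      where
      cost-r : cost (x ∷ r) ≡ suc (w x z * suc n) + cost r
      cost-r = cost-head r (proj₁ path′)
      cheaper : cost r < cost (z ∷ p) → cost (x ∷ r) < cost (x ∷ z ∷ p)
      cheaper lt = subst₂ _<_ (sym cost-r) (sym (cost-∷ x z p)) (+-monoʳ-< (suc (w x z * suc n)) lt)
      equal : cost r ≡ cost (z ∷ p) → cost (x ∷ r) ≡ cost (x ∷ z ∷ p)
      equal e = trans cost-r (trans (cong (suc (w x z * suc n) +_) e) (sym (cost-∷ x z p)))
      extend-⊲ : r ⊲ (z ∷ p) → (x ∷ r) ⊲ (x ∷ z ∷ p)
      extend-⊲ (b , b∈ , b∉ , g) = b , there b∈ , (λ { (here refl) → x∉ b∈ ; (there b∈′) → b∉ b∈′ }) , λ y y≺b →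
        (λ { (here e) → here e ; (there y∈) → there (proj₁ (g y y≺b) y∈) }) ,
        (λ { (here e) → here e ; (there y∈) → there (proj₂ (g y y≺b) y∈) })

  best-reverse : Best x y P → Best y x (reverse P)
  best-reverse {P = P} (path , f) = path-reverse G path , λ {Q} path′ Q⊏ → f (path-reverse G path′)
    ([ (λ lt → inj₁ (subst₂ _<_ (sym (cost-reverse Q)) (cost-reverse P) lt)) ,
       (λ (e , b , b∈ , b∉ , g) → inj₂ (trans (cost-reverse Q) (trans e (cost-reverse P)) ,
         b , reverse⁺ b∈ , b∉ ∘ reverse⁺ , λ y y≺b →
           reverse⁻ ∘ proj₁ (g y y≺b) ∘ reverse⁻ , reverse⁺ ∘ proj₂ (g y y≺b) ∘ reverse⁺)) ]′ Q⊏)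

  lsp : Fin n → Fin n → Path
  lsp x y = proj₁ (best-exists x y)

  lsp-best : ∀ x y → Best x y (lsp x y)
  lsp-best x y = proj₂ (best-exists x y)

  system : ∀ {vs} → (∀ x → x ∈ vs) → PathSystem G vs lsp
  system all = record
    { support = λ _ → all _
    ; isPath = λ {x} {y} _ _ → proj₁ (lsp-best x y)
    ; suffix = λ {x} {y} {z} _ _ e → best-unique (lsp-best z y) (best-tail (subst (Best x y) e (lsp-best x y)))
    ; rev = λ {x} {y} _ _ → best-unique (lsp-best y x) (best-reverse (lsp-best x y)) }

  -- Equal length forces `Q` to have a vertex outside `P`: otherwise `b` and all vertices of `Q`
  -- would fit into `P`. The least such vertex lies above `b`, since below `b` the two paths have
  -- the same vertices.
  ⊲-lexicographic : Unique Q → length Q ≡ length P → P ⊲ Q →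
    Σ (Fin n) λ a → Σ (Fin n) λ b → IsMin _≺_ (Diff Q P) a × IsMin _≺_ (Diff P Q) b × b ≺ a
  ⊲-lexicographic {Q} {P} uQ len (b , b∈ , b∉ , f) = by-least (any? (diff? Q P))
    where
    min-b : IsMin _≺_ (Diff P Q) b
    min-b = (b∈ , b∉) , λ y (y∈ , y∉) → above y (λ y≺b → y∉ (proj₁ (f y y≺b) y∈))
      where
      above : ∀ y → ¬ y ≺ b → b ≡ y ⊎ b ≺ y
      above y ¬lt with compare b y
      ... | tri< lt _ _ = inj₂ lt
      ... | tri≈ _ e _ = inj₁ e
      ... | tri> _ _ gt = contradiction gt ¬lt
    by-least : Dec (∃ (Diff Q P)) → _
    by-least (no none) = contradiction
      (unique-⊆-length (b ∷ Q) (¬Any⇒All¬ Q b∉ ∷ uQ) λ { (here refl) → b∈ ; (there y∈) → not-diff Q P (λ d → none (_ , d)) y∈ })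
      (<⇒≱ (s≤s (≤-reflexive (sym len))))
    by-least (yes some) with least (diff? Q P) some
    ... | a , m@((a∈ , a∉) , _) = a , b , m , min-b , b≺a
      where
      b≺a : b ≺ a
      b≺a with compare b a
      ... | tri< lt _ _ = lt
      ... | tri≈ _ refl _ = contradiction b∈ a∉
      ... | tri> _ _ gt = contradiction (proj₂ (f a gt) a∈) a∉

  numEdges-length : IsPath G x y P → IsPath G x y Q → numEdges P ≡ numEdges Q → length P ≡ length Q
  numEdges-length {P = _ ∷ _} {_ ∷ _} _ _ e = cong suc e

  best⇒lexShortest : Best x y P → IsLexShortest G w _≺_ x y P
  best⇒lexShortest {x} {y} {P} B@(path@(_ , _ , u , _) , f) = path , compare-with
    where
    compare-with : ∀ Q → IsPath G x y Q → Q ≢ P → _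
    compare-with Q path′@(_ , _ , u′ , _) Q≢P with cost-≤ P Q u′ (proj₂ (best-cheapest B) path′)
    ... | inj₁ lt = inj₁ lt
    ... | inj₂ (e , le) with <-cmp (length P) (length Q)
    ... | tri< lt _ _ = inj₂ (inj₁ (sym e , ∸-monoˡ-< lt (nonempty path)))
      where
      nonempty : ∀ {P} → IsPath G x y P → 1 ≤ length P
      nonempty {_ ∷ _} _ = s≤s z≤n
    ... | tri> _ _ gt = contradiction le (<⇒≱ gt)
    ... | tri≈ _ len _ with ⊲-cmp P Q
    ... | inj₁ a = inj₂ (inj₂ (sym e , cong (_∸ 1) (sym len) , ⊲-lexicographic u′ (sym len) a))
    ... | inj₂ (inj₁ a) = contradiction (inj₂ (cong₂ (λ i j → i * suc n + j) (sym e) (sym len) , a)) (f path′)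
    -- With the same cost and the same vertices `Q` is cheapest too, hence equal to `P`.
    ... | inj₂ (inj₂ same) =
      contradiction (sym (cheapest-unique (best-cheapest B) (path′ , cheapest) (proj₁ (same _)) (proj₂ (same _)))) Q≢P
      where
      cheapest : ∀ {R} → IsPath G x y R → cost Q ≤ cost R
      cheapest {R} path″ = subst (_≤ cost R) (cong₂ (λ i j → i * suc n + j) e len) (proj₂ (best-cheapest B) path″)

  -- If the two differed, each of the three alternatives would put `P` strictly before `lsp x y`,
  -- which is best.
  lexShortest⇒lsp : IsLexShortest G w _≺_ x y P → P ≡ lsp x y
  lexShortest⇒lsp {x} {y} {P} (path@(_ , _ , u , _) , f) = decidable-stable (List.≡-dec _≟_ P (lsp x y)) λ P≢ →
    proj₂ B path (beats (f (lsp x y) (proj₁ B) (≢-sym P≢)))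
    where
    B = lsp-best x y
    beats : _ → P ⊏ lsp x y
    beats (inj₁ lt) = inj₁ (cost-weight-< P (lsp x y) u lt)
    beats (inj₂ (inj₁ (e , lt))) = inj₁ (cost-length-< P (lsp x y) (sym e) (shorter lt))
      where
      shorter : ∀ {k l} → k ∸ 1 < l ∸ 1 → k < l
      shorter {k} {l} lt = ≰⇒> (λ le → <⇒≱ lt (∸-monoˡ-≤ 1 le))
    beats (inj₂ (inj₂ (e , len , a , b , min-a , min-b@((b∈ , b∉) , _) , b≺a))) =
      inj₂ (cong₂ (λ i j → i * suc n + j) (sym e) (sym (numEdges-length (proj₁ B) path len)) ,
        b , b∈ , b∉ , λ y y≺b →
          -- Below `b` the paths agree, as `b` is least in one difference and lies below the least
          -- vertex `a` of the other.
          not-diff P (lsp _ _) (below-least min-b y≺b) , not-diff (lsp _ _) P (below-least min-a (≺-trans y≺b b≺a)))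

theorem1 : ∀ {n} (G : Graph n) (w : Fin n → Fin n → ℕ) (_≺_ : Rel (Fin n) 0ℓ) →
    0 < n → Connected G → IsPartial2Tree G →
    (∀ i j → w i j ≡ w j i) →
    IsStrictTotalOrder _≡_ _≺_ →
    Σ (List (List (Fin n))) λ L →
    All (IsLexShortCycle G w _≺_) L ×
    AllPairs (λ c c′ → ¬ SameCycle c c′) L ×
    (∀ C → IsLexShortCycle G w _≺_ C → Any (SameCycle C) L) ×
    length L + n ≡ edgeCount G + 1
theorem1 {n} G w _≺_ 0<n connected (k , T , twoTree , f , f-inj , hom) w-sym sto =
  let L , (short , distinct , complete) , size = count-all (elim-twoTree twoTree g represents) everything
  in L , All.map short⇒lexShort short , distinct , (λ C → complete C ∘ lexShort⇒short {C}) , size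
  where
  open Shortest G w _≺_ connected w-sym sto

  -- The 2-tree pulled back along `f`; it contains `G` by `hom`.
  R : Fin n → Fin n → Set
  R x y = T (f x) (f y) ≡ true

  -- The partial inverse of `f`, marking which vertices of the 2-tree represent vertices of `G`.
  g : Fin k → Maybe (Fin n)
  g i with any? (λ x → f x ≟ i)
  ... | yes (x , _) = just x
  ... | no _ = nothing

  g-sound : ∀ {i x} → g i ≡ just x → f x ≡ i
  g-sound {i} e with any? (λ x → f x ≟ i)
  g-sound refl | yes (x , fx) = fx

  g-complete : ∀ x → g (f x) ≡ just x
  g-complete x with any? (λ y → f y ≟ f x)
  ... | yes (y , e) = cong just (f-inj e)
  ... | no none = contradiction (x , refl) none

  represents : Represents g T R
  represents = record
    { inj  = λ e e′ → trans (sym (g-sound e)) (g-sound e′)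
    ; to   = λ e e′ r → subst₂ (λ i j → T i j ≡ true) (g-sound e) (g-sound e′) r
    ; from = λ e e′ r → subst₂ (λ i j → T i j ≡ true) (sym (g-sound e)) (sym (g-sound e′)) r }

  everything : ∀ x → x ∈ collect g
  everything x = ∈-collect⁺ g (f x) (g-complete x)

  count-all : ∀ {vs} → Elim R vs → (∀ x → x ∈ vs) → ∃ λ L → Enumerates G lsp L × length L + n ≡ edgeCount G + 1
  -- The induction starts from one vertex, so the empty order is ruled out by `0 < n`.
  count-all {[]} _ all = contradiction (all (fromℕ< 0<n)) λ ()
  count-all {vs@(_ ∷ _)} E all =
    let L , enum , size = counted E (system all) (hom _ _)
    in L , enum , subst₂ (λ a b → length L + a ≡ b + 1)
         (trans (↭-length perm) (length-tabulate id))
         (trans (edges-↭ G perm) (sym (edgeCount-edges G))) size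
    where
    perm : vs ↭ allFin n
    perm = ∼bag⇒↭ (unique∧set⇒bag (elim-unique E) (allFin⁺ n) (mk⇔ (λ _ → ∈-allFin _) (λ _ → all _)))

  short⇒lexShort : ∀ {C} → Short G lsp C → IsLexShortCycle G w _≺_ C
  short⇒lexShort (cyc , h) = cyc , λ x y x∈ y∈ _ → lsp x y , best⇒lexShortest (lsp-best x y) , h x y x∈ y∈

  lexShort⇒short : ∀ {C} → IsLexShortCycle G w _≺_ C → Short G lsp C
  lexShort⇒short {C} (cyc , h) = cyc , λ x y x∈ y∈ → convex x∈ y∈ (x ≟ y)
    where
    convex : ∀ {x y} → x ∈ C → y ∈ C → Dec (x ≡ y) → PathInCycle (lsp x y) C
    convex {x} x∈ _ (yes refl) = subst (λ p → PathInCycle p C) (sym (path-trivial {G = G} (proj₁ (lsp-best x x))))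
      ((λ { _ (here refl) → x∈ }) , λ _ _ ())
    convex {x} {y} x∈ y∈ (no x≢y) =
      let _ , lex , inside = h x y x∈ y∈ x≢y in subst (λ q → PathInCycle q C) (lexShortest⇒lsp lex) inside
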